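{- Let $P$ be a finite poset, $\ell,q$ positive integers, $u,v$ as in the context, and assume the restriction function $R^q$ is defined. For every $f\in\mathcal L_{P\times[\ell]}(u,v,R^q)$, $\mathrm{JdtPro}(f)=\mathrm{Pro}(f)$.
   Context: $P\times[\ell]=\{(p,i):p\in P,1\le i\le\ell\}$; $u,v:P\to\{0,\ldots,\ell\}$ satisfy $u(p)+v(p)\le\ell$ and $v(p_1)\le v(p_2)$, $u(p_1)\ge u(p_2)$ when $p_1\le_Pp_2$; $P\times[\ell]^v_u=\{(p,i):u(p)<i<\ell+1-v(p)\}$, fibers $F_p=\{(p,i)\in P\times[\ell]^v_u\}$. For a map $R$ from $P$ to nonempty finite subsets of $\mathbb Z$, $\mathcal L_{P\times[\ell]}(u,v,R)$ is the set of $f:P\times[\ell]^v_u\to\mathbb Z$ with $f(p_1,i)<f(p_2,i)$ for $p_1<_Pp_2$, $f(p,i_1)\le f(p,i_2)$ for $i_1\le i_2$, $f(p,i)\in R(p)$. $R^q(p)$ is the set of $k\in\{1,\ldots,q\}$ attained as $f(p,i)$ by some $f\in\mathcal L_{P\times[\ell]}(u,v,p\mapsto\{1,\ldots,q\})$ (assumed nonempty). With $R=R^q$: $R(p)_{>k}$ is the smallest element of $R(p)$ greater than $k$; $f(p,i)$ is raisable (lowerable) if some $g\in\mathcal L_{P\times[\ell]}(u,v,R)$ has $g(p,i)>f(p,i)$ (resp. $<$) and $g(p',i')=f(p',i')$ whenever $p'\ne p$. Bender–Knuth $\rho_k$: in each fiber $F_p$ with $k\in R(p)$, $k\ne\max R(p)$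 (others unchanged), the free labels are raisable labels equal to $k$ and lowerable labels equal to $R(p)_{>k}$; if they read $a$ copies of $k$ then $b$ copies of $R(p)_{>k}$, replace by $b$ copies of $k$ then $a$ copies of $R(p)_{>k}$. $\mathrm{Pro}=\cdots\circ\rho_2\circ\rho_1\circ\rho_0\circ\rho_{ -1}\circ\cdots$. Jeu de taquin: for $g:P\times[\ell]^v_u\to\mathbb Z\cup\{\square\}$, $\mathrm{jdt}_i(g)(p,k)$ (all referenced elements in $P\times[\ell]^v_u$) equals: $i$ if $g(p,k)=\square$ and $g(p',k)=i$ for some $p'\gtrdot_Pp$; $i$ if $g(p,k)=\square$, $g(p,k+1)=i$ and $g(p',k+1)\ne\square$ for every $p'\lessdot_Pp$; $\square$ if $g(p,k)=i$ and $g(p',k)=\square$ for some $p'\lessdot_Pp$; $\square$ if $g(p,k)=i$, $g(p,k-1)=\square$ and $g(p',k-1)\ne i$ for every $p'\gtrdot_Pp$; $g(p,k)$ otherwise. $\mathrm{jdt}_{i\to j}$ replaces all labels $i$ by $j$. $\mathrm{jdt}(f)=\mathrm{jdt}_{\square\to q+1}\circ(\mathrm{jdt}_q)^\ell\circ\cdots\circ(\mathrm{jdt}_2)^\ell\circ\mathrm{jdt}_{1\to\square}(f)$ and $\mathrm{JdtPro}(f)(x)=\mathrm{jdt}(f)(x)-1$. -}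

module Defs where

open import Data.Nat using (ℕ; zero; suc; _+_; _∸_; _≤_; _<_; _≤?_; _<?_)
open import Data.Nat.Properties using () renaming (_≟_ to _≟ℕ_)
open import Data.Fin using (Fin)
open import Data.Fin.Properties using (all?) renaming (_≟_ to _≟F_)
open import Data.Bool using (Bool; true; false; _∧_; _∨_; not; if_then_else_)
open import Data.Maybe using (Maybe; just; nothing)
open import Data.List using (List; allFin; upTo; map; foldl)
open import Data.Bool.ListAction using (any; all)
open import Data.Product using (Σ; ∃; _×_; _,_)
open import Data.Sum using (_⊎_)
open import Relation.Nullary using (¬_; Dec; yes; no)
open import Relation.Nullary.Decidable using (⌊_⌋; _×-dec_; ¬?)
open import Relation.Binary using (IsDecPartialOrder)
open import Relation.Binary.PropositionalEquality using (_≡_; _≢_)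

-- The data fixed in the context: a finite poset P (carrier Fin n with a
-- decidable partial order), a positive length ℓ (positivity is a separate
-- hypothesis of the theorem), and u, v : P → {0,…,ℓ} with
-- u p + v p ≤ ℓ, v order-preserving, u order-reversing.

record Shape : Set₁ where
  field
    n      : ℕ
    _≤P_   : Fin n → Fin n → Set
    isDPO  : IsDecPartialOrder _≡_ _≤P_
    ℓ      : ℕ
    u v    : Fin n → ℕ
    u+v≤ℓ  : ∀ p → u p + v p ≤ ℓ
    v-mono : ∀ {p₁ p₂} → p₁ ≤P p₂ → v p₁ ≤ v p₂
    u-anti : ∀ {p₁ p₂} → p₁ ≤P p₂ → u p₂ ≤ u p₁

data CountBelow (A : ℕ → Set) : ℕ → ℕ → Set where
  cnt-zero : CountBelow A 0 0
  cnt-yes  : ∀ {m c} → A m → CountBelow A m c → CountBelow A (suc m) (suc c)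
  cnt-no   : ∀ {m c} → ¬ A m → CountBelow A m c → CountBelow A (suc m) c

iter : ∀ {A : Set} → ℕ → (A → A) → A → A
iter zero    h x = x
iter (suc m) h x = h (iter m h x)

module _ (S : Shape) where
  open Shape S
  open IsDecPartialOrder isDPO using () renaming (_≤?_ to _≤P?_)

  P : Set
  P = Fin n

  _<P_ : P → P → Set
  p₁ <P p₂ = p₁ ≤P p₂ × p₁ ≢ p₂

  _⋖_ : P → P → Set
  p ⋖ p' = p <P p' × (∀ r → ¬ (p <P r × r <P p'))

  _<P?_ : ∀ p₁ p₂ → Dec (p₁ <P p₂)
  p₁ <P? p₂ = (p₁ ≤P? p₂) ×-dec ¬? (p₁ ≟F p₂)

  _⋖?_ : ∀ p p' → Dec (p ⋖ p')
  p ⋖? p' = (p <P? p') ×-dec all? (λ r → ¬? ((p <P? r) ×-dec (r <P? p')))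

  Dom : P → ℕ → Set
  Dom p i = u p < i × i < suc ℓ ∸ v p

  domB : P → ℕ → Bool
  domB p i = ⌊ u p <? i ⌋ ∧ ⌊ i <? suc ℓ ∸ v p ⌋

  -- labelings (only the values on P × [ℓ]^v_u are meaningful)
  Labeling : Set
  Labeling = P → ℕ → ℕ

  Restriction : Set₁
  Restriction = P → ℕ → Set

  InL : Restriction → Labeling → Set
  InL R f =
    (∀ p₁ p₂ i → p₁ <P p₂ → Dom p₁ i → Dom p₂ i → f p₁ i < f p₂ i) ×
    (∀ p i₁ i₂ → i₁ ≤ i₂ → Dom p i₁ → Dom p i₂ → f p i₁ ≤ f p i₂) ×
    (∀ p i → Dom p i → R p (f p i))

  Interval : ℕ → Restriction
  Interval q p k = 1 ≤ k × k ≤ q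

  RqDefined : ℕ → Set
  RqDefined q = ∃ λ g → InL (Interval q) g

  Rq : ℕ → Restriction
  Rq q p k = 1 ≤ k × k ≤ q ×
             (∃ λ g → InL (Interval q) g × (∃ λ i → Dom p i × g p i ≡ k))

  AgreeOff : P → Labeling → Labeling → Set
  AgreeOff p f g = ∀ p' i → p' ≢ p → Dom p' i → g p' i ≡ f p' i

  Raisable : Restriction → Labeling → P → ℕ → Set
  Raisable R f p i = ∃ λ g → InL R g × f p i < g p i × AgreeOff p f g

  Lowerable : Restriction → Labeling → P → ℕ → Set
  Lowerable R f p i = ∃ λ g → InL R g × g p i < f p i × AgreeOff p f g

  -- Bender–Knuth toggle ρ_k (with R = R^q), given as its graph:
  -- BK q k f g  means  g = ρ_k(f)  (on P × [ℓ]^v_u).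

  Active : ℕ → P → ℕ → Set
  Active q p k = Rq q p k × (∃ λ r → Rq q p r × k < r)

  IsNext : ℕ → P → ℕ → ℕ → Set
  IsNext q p k nxt = Rq q p nxt × k < nxt × (∀ r → Rq q p r → k < r → nxt ≤ r)

  Free : ℕ → Labeling → P → ℕ → ℕ → ℕ → Set
  Free q f p k nxt i =
    Dom p i × ((f p i ≡ k × Raisable (Rq q) f p i) ⊎
               (f p i ≡ nxt × Lowerable (Rq q) f p i))

  -- the free labels of F_p, read in order, consist of a copies of k and
  -- b copies of nxt (b counted below); they are replaced by b copies of k
  -- followed by a copies of nxt; all other labels of F_p are unchanged.
  Swap : ℕ → P → ℕ → ℕ → Labeling → Labeling → Set
  Swap q p k nxt f g =
    (∀ i → Dom p i → ¬ Free q f p k nxt i → g p i ≡ f p i) ×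
    (∀ b → CountBelow (λ j → Free q f p k nxt j × f p j ≡ nxt) (suc ℓ) b →
     ∀ i c → Free q f p k nxt i → CountBelow (Free q f p k nxt) i c →
       (c < b → g p i ≡ k) × (b ≤ c → g p i ≡ nxt))

  BK : ℕ → ℕ → Labeling → Labeling → Set
  BK q k f g = ∀ p →
    (¬ Active q p k → ∀ i → Dom p i → g p i ≡ f p i) ×
    (Active q p k → ∀ nxt → IsNext q p k nxt → Swap q p k nxt f g)

  ProSteps : ℕ → ℕ → Labeling → Labeling → Set
  ProSteps q zero    f h = ∀ p i → Dom p i → h p i ≡ f p i
  ProSteps q (suc m) f h = ∃ λ g → ProSteps q m f g × BK q (suc m) g h

  -- Pro(f) = h.  Since R^q(p) ⊆ {1,…,q}, ρ_k is the identity unless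
  -- 1 ≤ k < q, so Pro = ρ_q ∘ ⋯ ∘ ρ_1.
  ProIs : ℕ → Labeling → Labeling → Set
  ProIs q f h = ProSteps q q f h

  -- jeu de taquin; nothing plays the role of □

  BLabeling : Set
  BLabeling = P → ℕ → Maybe ℕ

  isBox : Maybe ℕ → Bool
  isBox nothing  = true
  isBox (just _) = false

  isLab : ℕ → Maybe ℕ → Bool
  isLab i nothing  = false
  isLab i (just j) = ⌊ j ≟ℕ i ⌋

  anyP : (P → Bool) → Bool
  anyP t = any t (allFin n)

  allP : (P → Bool) → Bool
  allP t = all t (allFin n)

  covB : P → P → Bool
  covB p p' = ⌊ p ⋖? p' ⌋

  jdtStep : ℕ → BLabeling → BLabeling
  jdtStep i g p k =
    if isBox (g p k) then
      (if anyP (λ p' → covB p p' ∧ domB p' k ∧ isLab i (g p' k))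
       then just i
       else if domB p (suc k) ∧ isLab i (g p (suc k)) ∧
               allP (λ p' → not (covB p' p ∧ domB p' (suc k)) ∨
                            not (isBox (g p' (suc k))))
       then just i
       else g p k)
    else if isLab i (g p k) then
      (if anyP (λ p' → covB p' p ∧ domB p' k ∧ isBox (g p' k))
       then nothing
       else if domB p (k ∸ 1) ∧ isBox (g p (k ∸ 1)) ∧
               allP (λ p' → not (covB p p' ∧ domB p' (k ∸ 1)) ∨
                            not (isLab i (g p' (k ∸ 1))))
       then nothing
       else g p k)
    else g p k

  oneToBox : Labeling → BLabeling
  oneToBox f p k with f p k
  ... | 1 = nothing
  ... | j = just j

  boxTo : ℕ → BLabeling → Labeling
  boxTo q g p k with g p k
  ... | nothing = suc q
  ... | just j  = j

  sweeps : ℕ → BLabeling → BLabeling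
  sweeps q g = foldl (λ h i → iter ℓ (jdtStep i) h) g (map (2 +_) (upTo (q ∸ 1)))

  jdt : ℕ → Labeling → Labeling
  jdt q f = boxTo q (sweeps q (oneToBox f))

  JdtPro : ℕ → Labeling → Labeling
  JdtPro q f p k = jdt q f p k ∸ 1

{-# OPTIONS --safe #-}

-- Just before the sweep jdt_{k+1}, read □ as k and subtract 1 from every label already
-- swept; this turns the current filling into an element g of L(u,v,R^q), and the claim
-- is that the sweep acts on g as ρ_k.
--
-- In a fiber the labels k, k+1 of g form four consecutive runs: blocked k (some k+1 lies
-- above in the same layer), free k, free k+1, blocked k+1.  The first jdt step exchanges
-- all blocked pairs at once, and after that no vertical slide is possible.  So the
-- remaining dynamics lives in the separate fibers: the word □^a (k+1)^b on the free run
-- evolves by exchanging all adjacent pairs □ (k+1) simultaneously.  The r-th label k+1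
-- starts to move at time r and then moves at every step until it has passed all a boxes,
-- so after a + b ≤ ℓ steps the word is (k+1)^b □^a, which reads k^b (k+1)^a.
module Submission where

open import Defs
open import Data.Bool using (Bool; true; false; if_then_else_; T; _∧_; _∨_; not)
open import Data.Bool.Properties using (T-∧)
open import Data.Empty using (⊥)
open import Data.Fin.Properties using (any?) renaming (_≟_ to _≟F_)
open import Data.List using (allFin; upTo; map; foldl; _∷ʳ_; _∷_; [])
open import Data.List.Membership.Propositional using (lose)
open import Data.List.Membership.Propositional.Properties using (∈-allFin)
open import Data.List.Properties using (upTo-∷ʳ; map-++; foldl-∷ʳ)
open import Data.List.Relation.Unary.All using (lookup; universal)
open import Data.List.Relation.Unary.All.Properties using (all⁺; all⁻)
open import Data.List.Relation.Unary.Any using (satisfied)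
open import Data.List.Relation.Unary.Any.Properties using (any⁺; any⁻)
open import Data.Maybe using (Maybe; just; nothing)
open import Data.Maybe.Properties using (just-injective)
open import Data.Nat
open import Data.Nat.Properties
open import Data.Product using (∃; _×_; _,_; proj₁; proj₂)
open import Data.Sum using (_⊎_; inj₁; inj₂)
open import Function using (_∘_)
open import Function.Bundles using (Equivalence)
open import Relation.Binary using (tri<; tri≈; tri>)
open import Relation.Binary.PropositionalEquality
open import Relation.Nullary using (¬_; Dec; yes; no; contradiction)
open import Relation.Nullary.Decidable using (toWitness; fromWitness; ⌊_⌋; _×-dec_; _⊎-dec_; ¬?)

open Equivalence using (to; from)

-- Parallel sorting of a two-letter word by neighbour exchanges

-- One parallel step on a word in which true stands for the label k+1 and false for □.
shift : (ℕ → Bool) → ℕ → Bool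
shift w zero    = if w 0 then true else w 1
shift w (suc j) = if w (suc j) then w j else w (suc (suc j))

module _ (w : ℕ → Bool) where

  shift-stay : ∀ j → w j ≡ true → (∀ i → suc i ≡ j → w i ≡ true) → shift w j ≡ true
  shift-stay zero    wj _    rewrite wj = refl
  shift-stay (suc j) wj left rewrite wj = left j refl

  shift-enter : ∀ j → w j ≡ false → shift w j ≡ w (suc j)
  shift-enter zero    wj rewrite wj = refl
  shift-enter (suc j) wj rewrite wj = refl

  shift-leave : ∀ j → w (suc j) ≡ true → shift w (suc j) ≡ w j
  shift-leave j wj rewrite wj = refl

-- Only the middle of such a word moves: the first `s` letters are jammed, and the letters after the
-- last particle stay false. Run widths are the parameters because sorting amounts to exchanging the
-- runs of widths `a` and `b`.
module Particles (s a b : ℕ) (w : ℕ → Bool)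
  (left  : ∀ j → j < s → w j ≡ true)
  (holes : ∀ j → s ≤ j → j < a + s → w j ≡ false)
  (parts : ∀ j → a + s ≤ j → j < b + (a + s) → w j ≡ true)
  (right : ∀ j → b + (a + s) ≤ j → w j ≡ false)
  where

  state : ℕ → ℕ → Bool
  state t = iter t shift w

  at : ∀ {v} t {i j} → state t i ≡ v → i ≡ j → state t j ≡ v
  at {v} t eq p = subst (λ x → state t x ≡ v) p eq

  state-left : ∀ t j → j < s → state t j ≡ true
  state-left zero    j j<s = left j j<s
  state-left (suc t) j j<s =
    shift-stay (state t) j (state-left t j j<s)
      (λ { i refl → state-left t i (<-trans (n<1+n i) j<s) })

  state-right : ∀ t j → b + (a + s) ≤ j → state t j ≡ false
  state-right zero    j e≤j = right j e≤j
  state-right (suc t) j e≤j =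
    trans (shift-enter (state t) j (state-right t j e≤j))
          (state-right t (suc j) (m≤n⇒m≤1+n e≤j))

  -- Position at time t of the r-th particle from the left, resp. the r-th hole from the
  -- right: particle r and hole r' are exchanged in the step from time r + r' to r + r' + 1.
  particle : ℕ → ℕ → ℕ
  particle t r = r + (a ∸ (t ∸ r)) + s

  hole : ℕ → ℕ → ℕ
  hole t r = b ⊓ (t ∸ r) + (a ∸ suc r) + s

  -- Truncated subtraction encodes three phases. A particle waits until time `r`, then moves left
  -- one place per step, and rests after `a` moves; a hole likewise moves right and rests after `b`
  -- moves.
  particle-early : ∀ t r → t ≤ r → particle t r ≡ r + a + s
  particle-early t r t≤r = cong (λ x → r + (a ∸ x) + s) (m≤n⇒m∸n≡0 t≤r)

  particle-mid : ∀ r d → particle (r + d) r ≡ r + (a ∸ d) + s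
  particle-mid r d = cong (λ x → r + (a ∸ x) + s) (m+n∸m≡n r d)

  particle-late : ∀ t r → a + r ≤ t → particle t r ≡ r + s
  particle-late t r p = trans
    (cong (λ x → r + x + s) (m≤n⇒m∸n≡0 (m+n≤o⇒m≤o∸n a p)))
    (cong (_+ s) (+-identityʳ r))

  hole-early : ∀ t r → t ≤ r → hole t r ≡ (a ∸ suc r) + s
  hole-early t r t≤r = cong (λ x → x + (a ∸ suc r) + s)
    (trans (cong (b ⊓_) (m≤n⇒m∸n≡0 t≤r)) (⊓-zeroʳ b))

  hole-mid : ∀ r d → d ≤ b → hole (r + d) r ≡ d + (a ∸ suc r) + s
  hole-mid r d d≤b = cong (λ x → x + (a ∸ suc r) + s)
    (trans (cong (b ⊓_) (m+n∸m≡n r d)) (m≥n⇒m⊓n≡n d≤b))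

  hole-late : ∀ t r → b + r ≤ t → hole t r ≡ b + (a ∸ suc r) + s
  hole-late t r p = cong (λ x → x + (a ∸ suc r) + s) (m≤n⇒m⊓n≡m (m+n≤o⇒m≤o∸n b p))

  ∸-pred : ∀ r → r < a → suc (a ∸ suc r) ≡ a ∸ r
  ∸-pred r r<a = sym (+-∸-assoc 1 r<a)

  Occupied Vacant : ℕ → Set
  Occupied t = ∀ r → r < b → state t (particle t r) ≡ true
  Vacant   t = ∀ r → r < a → state t (hole t r) ≡ false

  -- A waiting particle stands right after its predecessor, which has not moved either; a moving one
  -- has a hole on its left; a settled one has a filled place there. Only the moving case draws on
  -- `Vacant`.
  occupied-suc : ∀ t → Occupied t → Vacant t → Occupied (suc t)
  occupied-suc t occ vac r r<b with t <? r
  occupied-suc t occ vac (suc r) r<b | yes (s≤s t≤r) =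
    at (suc t)
      (shift-stay (state t) (suc r + a + s)
        (at t (occ (suc r) r<b) (particle-early t (suc r) (m≤n⇒m≤1+n t≤r)))
        (λ { i refl → at t (occ r (<-trans (n<1+n r) r<b)) (particle-early t r t≤r) }))
      (sym (particle-early (suc t) (suc r) (s≤s t≤r)))
  ... | no t≮r with m≤n⇒∃[o]m+o≡n (≮⇒≥ t≮r)
  -- At time `r + d` the left neighbour of particle `r` is hole `d`, as long as `d < a`.
  ... | d , refl with d <? a
  ... | yes d<a = at (suc (r + d))
    (trans (shift-enter (state (r + d)) x
              (at (r + d) (vac d d<a)
                (trans (cong (λ t → hole t d) (+-comm r d)) (hole-mid d r (<⇒≤ r<b)))))
           (at (r + d) (occ r r<b)
             (trans (particle-mid r d)
               (cong (_+ s) (trans (cong (r +_) (sym (∸-pred d d<a))) (+-suc r _))))))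
    (sym (trans (cong (λ t → particle t r) (sym (+-suc r d))) (particle-mid r (suc d))))
    where x = r + (a ∸ suc d) + s
  ... | no d≮a = at (suc (r + d))
    (shift-stay (state (r + d)) (r + s)
      (at (r + d) (occ r r<b) (particle-late (r + d) r a+r≤t))
      prev)
    (sym (particle-late (suc (r + d)) r (m≤n⇒m≤1+n a+r≤t)))
    where
    a+r≤t : a + r ≤ r + d
    a+r≤t = subst (_≤ r + d) (+-comm r a) (+-monoʳ-≤ r (≮⇒≥ d≮a))
    -- The place to the left belongs to the previous particle, which settled earlier, or to the left
    -- padding when there is none.
    before : ∀ r' i → r' < b → a + r' ≤ r + d → suc i ≡ r' + s → state (r + d) i ≡ true
    before zero     i _ _ eq = state-left (r + d) i (≤-reflexive eq)
    before (suc r') i lt le refl = at (r + d)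
      (occ r' (<-trans (n<1+n r') lt))
      (particle-late (r + d) r' (≤-trans (+-monoʳ-≤ a (n≤1+n r')) le))
    prev : ∀ i → suc i ≡ r + s → state (r + d) i ≡ true
    prev i = before r i r<b a+r≤t

  -- Mirror argument: a waiting hole has another hole on its right, a moving one has a particle
  -- there, and a settled one has a settled hole or the right padding there.
  vacant-suc : ∀ t → Occupied t → Vacant t → Vacant (suc t)
  vacant-suc t occ vac r r<a with t <? r
  vacant-suc t occ vac (suc r) r<a | yes (s≤s t≤r) = at (suc t)
    (trans (shift-enter (state t) (a ∸ suc (suc r) + s)
             (at t (vac (suc r) r<a) (hole-early t (suc r) (m≤n⇒m≤1+n t≤r))))
           (at t (vac r (<-trans (n<1+n r) r<a))
             (trans (hole-early t r t≤r) (cong (_+ s) (sym (∸-pred (suc r) r<a))))))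
    (sym (hole-early (suc t) (suc r) (s≤s t≤r)))
  ... | no t≮r with m≤n⇒∃[o]m+o≡n (≮⇒≥ t≮r)
  ... | d , refl with d <? b
  ... | yes d<b = at (suc (r + d))
    (trans (shift-leave (state (r + d)) x
              (at (r + d) (occ d d<b)
                (trans (cong (λ t → particle t d) (+-comm r d))
                (trans (particle-mid d r)
                  (cong (_+ s) (trans (cong (d +_) (sym (∸-pred r r<a))) (+-suc d _)))))))
           (at (r + d) (vac r r<a) (hole-mid r d (<⇒≤ d<b))))
    (sym (trans (cong (λ t → hole t r) (sym (+-suc r d))) (hole-mid r (suc d) d<b)))
    where x = d + (a ∸ suc r) + s
  ... | no d≮b = at (suc (r + d))
    (trans (shift-enter (state (r + d)) (b + (a ∸ suc r) + s)
              (at (r + d) (vac r r<a) (hole-late (r + d) r b+r≤t)))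
           (next r r<a b+r≤t))
    (sym (hole-late (suc (r + d)) r (m≤n⇒m≤1+n b+r≤t)))
    where
    b+r≤t : b + r ≤ r + d
    b+r≤t = subst (_≤ r + d) (+-comm r b) (+-monoʳ-≤ r (≮⇒≥ d≮b))
    bump : ∀ r' → r' < a → b + (a ∸ r') + s ≡ suc (b + (a ∸ suc r') + s)
    bump r' lt = cong (_+ s) (trans (cong (b +_) (sym (∸-pred r' lt))) (+-suc b _))
    next : ∀ r' → r' < a → b + r' ≤ r + d → state (r + d) (suc (b + (a ∸ suc r') + s)) ≡ false
    next zero     lt _  = state-right (r + d) _
      (≤-reflexive (trans (sym (+-assoc b a s)) (bump 0 lt)))
    next (suc r') lt le = at (r + d)
      (vac r' (<-trans (n<1+n r') lt))
      (trans (hole-late (r + d) r' (≤-trans (+-monoʳ-≤ b (n≤1+n r')) le)) (bump (suc r') lt))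

  occupied : ∀ t → Occupied t
  vacant   : ∀ t → Vacant t
  occupied zero r r<b = at 0
    (parts (r + (a + s)) (m≤n+m (a + s) r) (+-monoˡ-< (a + s) r<b))
    (trans (sym (+-assoc r a s)) (sym (particle-early 0 r z≤n)))
  occupied (suc t) = occupied-suc t (occupied t) (vacant t)
  vacant zero r r<a = at 0
    (holes (a ∸ suc r + s) (m≤n+m s _)
      (+-monoˡ-< s (subst (_≤ a) (sym (∸-pred r r<a)) (m∸n≤m a r))))
    (sym (hole-early 0 r z≤n))
  vacant (suc t) = vacant-suc t (occupied t) (vacant t)

  -- Particle `r` rests from time `a + r` on, and `r < b`; so at time `a + b` all particles sit
  -- directly after the left padding.
  sorted-left : ∀ t → a + b ≤ t → ∀ j → j < b + s → state t j ≡ true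
  sorted-left t a+b≤t j j<b+s with j <? s
  ... | yes j<s = state-left t j j<s
  ... | no j≮s = at t (occupied t (j ∸ s) r<b)
          (trans (particle-late t (j ∸ s) (≤-trans (+-monoʳ-≤ a (<⇒≤ r<b)) a+b≤t)) back)
    where
    back : j ∸ s + s ≡ j
    back = m∸n+n≡m (≮⇒≥ j≮s)
    r<b : j ∸ s < b
    r<b = +-cancelʳ-< s (j ∸ s) b (subst (_< b + s) (sym back) j<b+s)

  sorted-right : ∀ t → a + b ≤ t → ∀ j → b + s ≤ j → state t j ≡ false
  sorted-right t a+b≤t j b+s≤j with j <? b + (a + s)
  ... | no j≮e = state-right t j (≮⇒≥ j≮e)
  -- Holes are numbered from the right, so the one resting at `j` has index `r` with
  -- `suc j + r ≡ b + (a + s)`; the bound `b + s ≤ j` gives `r < a`.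
  ... | yes j<e with m≤n⇒∃[o]m+o≡n j<e
  ... | r , eq = at t (vacant t r r<a)
          (trans (hole-late t r (≤-trans (≤-reflexive (+-comm b r))
                                (≤-trans (+-monoˡ-≤ b (<⇒≤ r<a)) a+b≤t)))
                 (suc-injective (+-cancelʳ-≡ r _ _ (trans lem (sym eq)))))
    where
    r<a : r < a
    r<a = +-cancelˡ-< (b + s) r a (≤-trans (s≤s (+-monoˡ-≤ r b+s≤j))
            (≤-reflexive (trans eq (trans (cong (b +_) (+-comm a s)) (sym (+-assoc b s a))))))
    lem : suc (b + (a ∸ suc r) + s) + r ≡ b + (a + s)
    lem = begin
      suc (b + (a ∸ suc r) + s) + r ≡⟨ cong (λ x → suc (x + r)) (+-assoc b _ s) ⟩
      suc (b + (a ∸ suc r + s)) + r ≡⟨ cong (_+ r) (sym (+-suc b _)) ⟩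
      b + (suc (a ∸ suc r) + s) + r ≡⟨ +-assoc b _ r ⟩
      b + (suc (a ∸ suc r) + s + r) ≡⟨ cong (λ x → b + (x + s + r)) (∸-pred r r<a) ⟩
      b + (a ∸ r + s + r)           ≡⟨ cong (b +_) (+-assoc (a ∸ r) s r) ⟩
      b + (a ∸ r + (s + r))         ≡⟨ cong (λ x → b + (a ∸ r + x)) (+-comm s r) ⟩
      b + (a ∸ r + (r + s))         ≡⟨ cong (b +_) (sym (+-assoc (a ∸ r) r s)) ⟩
      b + (a ∸ r + r + s)           ≡⟨ cong (λ x → b + (x + s)) (m∸n+n≡m (<⇒≤ r<a)) ⟩
      b + (a + s) ∎
      where open ≡-Reasoning

-- Cut points of down-closed predicates and counting on intervals

if-cases : ∀ {A : Set} b {x y z : A} → (T b → x ≡ z) → (¬ T b → y ≡ z) →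
           (if b then x else y) ≡ z
if-cases true  t f = t _
if-cases false t f = f (λ ())

-- Scanning down from `hi`, the cut lies just after the first place where `A` holds, since
-- closedness carries `A` to everything before it; if there is no such place, the cut is `lo`.
threshold : (A : ℕ → Set) → (∀ j → Dec (A j)) → ∀ lo hi → lo ≤ hi →
  (∀ i j → lo ≤ i → i ≤ j → j < hi → A j → A i) →
  ∃ λ s → lo ≤ s × s ≤ hi × (∀ j → lo ≤ j → j < s → A j) ×
          (∀ j → s ≤ j → j < hi → ¬ A j)
threshold A A? lo zero lo≤hi closed =
  zero , lo≤hi , z≤n , (λ _ _ ()) , (λ _ _ ())
threshold A A? lo (suc hi) lo≤hi closed with lo ≤? hi
... | no lo≰hi = lo , ≤-refl , lo≤hi ,
  (λ j lo≤j j<lo → contradiction lo≤j (<⇒≱ j<lo)) ,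
  (λ j lo≤j j<hi → contradiction (≤-trans lo≤j (≤-pred j<hi)) lo≰hi)
... | yes lo≤hi' with A? hi
... | yes ahi = suc hi , lo≤hi , ≤-refl ,
  (λ j lo≤j j<s → closed j hi lo≤j (≤-pred j<s) (n<1+n hi) ahi) ,
  (λ j s≤j j<hi → contradiction j<hi (≤⇒≯ s≤j))
... | no ¬ahi with threshold A A? lo hi lo≤hi'
                   (λ i j lo≤i i≤j j<hi → closed i j lo≤i i≤j (m≤n⇒m≤1+n j<hi))
... | s , lo≤s , s≤hi , below , above = s , lo≤s , m≤n⇒m≤1+n s≤hi , below , above'
  where
  above' : ∀ j → s ≤ j → j < suc hi → ¬ A j
  above' j s≤j j<hi with m≤n⇒m<n∨m≡n (≤-pred j<hi)
  ... | inj₁ j<hi' = above j s≤j j<hi'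
  ... | inj₂ refl  = ¬ahi

-- `m ⊓ y ∸ x` is the number of elements of `[x,y)` below `m`. This turns the relational counts in
-- `Swap` into arithmetic.
count-interval : ∀ {A : ℕ → Set} x y → x ≤ y →
  (∀ j → A j → x ≤ j × j < y) → (∀ j → x ≤ j → j < y → A j) →
  ∀ {m c} → CountBelow A m c → c ≡ m ⊓ y ∸ x
count-interval x y x≤y sound complete cnt-zero = sym (0∸n≡0 x)
count-interval x y x≤y sound complete (cnt-yes {m} am cnt) with sound m am
... | x≤m , m<y = begin
  suc _           ≡⟨ cong suc (count-interval x y x≤y sound complete cnt) ⟩
  suc (m ⊓ y ∸ x) ≡⟨ cong (λ z → suc (z ∸ x)) (m≤n⇒m⊓n≡m (<⇒≤ m<y)) ⟩
  suc (m ∸ x)     ≡⟨ +-∸-assoc 1 x≤m ⟨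
  suc m ∸ x       ≡⟨ cong (_∸ x) (m≤n⇒m⊓n≡m m<y) ⟨
  suc m ⊓ y ∸ x   ∎
  where open ≡-Reasoning
count-interval x y x≤y sound complete (cnt-no {m} ¬am cnt)
  with count-interval x y x≤y sound complete cnt | x ≤? m | m <? y
... | ih | yes x≤m | yes m<y = contradiction (complete m x≤m m<y) ¬am
... | ih | yes x≤m | no m≮y = trans ih (cong (_∸ x)
        (trans (m≥n⇒m⊓n≡n (≮⇒≥ m≮y)) (sym (m≥n⇒m⊓n≡n (m≤n⇒m≤1+n (≮⇒≥ m≮y))))))
... | ih | no x≰m | _ = trans ih (trans
        (m≤n⇒m∸n≡0 (≤-trans (m⊓n≤m m y) (<⇒≤ (≰⇒> x≰m))))
        (sym (m≤n⇒m∸n≡0 (≤-trans (m⊓n≤m (suc m) y) (≰⇒> x≰m)))))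

-- Jeu de taquin slides in propositional form

module _ (S : Shape) where
  open Shape S

  domB⁺ : ∀ {p i} → Dom S p i → T (domB S p i)
  domB⁺ {p} {i} (l , r) = from (T-∧ {⌊ u p <? i ⌋} {⌊ i <? suc ℓ ∸ v p ⌋})
    (fromWitness {a? = u p <? i} l , fromWitness {a? = i <? suc ℓ ∸ v p} r)

  domB⁻ : ∀ {p i} → T (domB S p i) → Dom S p i
  domB⁻ {p} {i} t with to (T-∧ {⌊ u p <? i ⌋}) t
  ... | l , r = toWitness {a? = u p <? i} l , toWitness {a? = i <? suc ℓ ∸ v p} r

  anyP⁺ : ∀ (t : P S → Bool) p → T (t p) → T (anyP S t)
  anyP⁺ t p tp = any⁺ t (lose (∈-allFin p) tp)

  anyP⁻ : ∀ (t : P S → Bool) → T (anyP S t) → ∃ λ p → T (t p)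
  anyP⁻ t = satisfied ∘ any⁻ t (allFin n)

  allP⁺ : ∀ (t : P S → Bool) → (∀ p → T (t p)) → T (allP S t)
  allP⁺ t tp = all⁻ t (universal tp (allFin n))

  allP⁻ : ∀ (t : P S → Bool) → T (allP S t) → ∀ p → T (t p)
  allP⁻ t ts p = lookup (all⁺ t (allFin n) ts) (∈-allFin p)

  -- Both vertical and both diagonal conditions of jdtStep have these two forms.
  module _ (c : P S → P S → Bool) (p : P S) where

    anyC : (P S → Bool) → ℕ → Bool
    anyC l k = anyP S (λ p' → c p p' ∧ domB S p' k ∧ l p')

    anyC⁺ : ∀ l k p' → T (c p p') → Dom S p' k → T (l p') → T (anyC l k)
    anyC⁺ l k p' cp d lp = anyP⁺ _ p' (from T-∧ (cp , from T-∧ (domB⁺ d , lp)))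

    anyC⁻ : ∀ l k → T (anyC l k) → ∃ λ p' → T (c p p') × Dom S p' k × T (l p')
    anyC⁻ l k t with anyP⁻ _ t
    ... | p' , tp with to (T-∧ {c p p'}) tp
    ... | cp , t' with to (T-∧ {domB S p' k}) t'
    ... | d , lp = p' , cp , domB⁻ d , lp

    noneC : (P S → Bool) → ℕ → Bool
    noneC l k = allP S (λ p' → not (c p p' ∧ domB S p' k) ∨ not (l p'))

    noneC⁺ : ∀ l k → (∀ p' → T (c p p') → Dom S p' k → ¬ T (l p')) → T (noneC l k)
    noneC⁺ l k no-l = allP⁺ _ λ p' → lem _ _ _ (λ cp d → no-l p' cp (domB⁻ d))
      where
      lem : ∀ x y z → (T x → T y → ¬ T z) → T (not (x ∧ y) ∨ not z)
      lem false _    _     h = _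
      lem true false _     h = _
      lem true true  false h = _
      lem true true  true  h = h _ _ _

    noneC⁻ : ∀ l k → T (noneC l k) → ∀ p' → T (c p p') → Dom S p' k → ¬ T (l p')
    noneC⁻ l k t p' cp d = lem _ _ _ (allP⁻ _ t p') cp (domB⁺ d)
      where
      lem : ∀ x y z → T (not (x ∧ y) ∨ not z) → T x → T y → ¬ T z
      lem true true true h _ _ _ = h

  covB⁺ : ∀ {p p'} → _⋖_ S p p' → T (covB S p p')
  covB⁺ = fromWitness

  covB⁻ : ∀ {p p'} → T (covB S p p') → _⋖_ S p p'
  covB⁻ = toWitness

  isBox⁺ : ∀ {x} → x ≡ nothing → T (isBox S x)
  isBox⁺ refl = _

  isBox⁻ : ∀ {x} → T (isBox S x) → x ≡ nothing
  isBox⁻ {nothing} _ = refl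

  isLab⁺ : ∀ {i x} → x ≡ just i → T (isLab S i x)
  isLab⁺ refl = fromWitness refl

  isLab⁻ : ∀ {i x} → T (isLab S i x) → x ≡ just i
  isLab⁻ {x = just j} t = cong just (toWitness t)

  module _ (i : ℕ) (h : BLabeling S) (p : P S) where

    LabelAbove : ℕ → Set
    LabelAbove j = ∃ λ p' → _⋖_ S p p' × Dom S p' j × h p' j ≡ just i

    BoxBelow : ℕ → Set
    BoxBelow j = ∃ λ p' → _⋖_ S p' p × Dom S p' j × h p' j ≡ nothing

    private
      above : ℕ → Bool
      above j = anyC (covB S) p (λ p' → isLab S i (h p' j)) j

      below : ℕ → Bool
      below j = anyC (λ p p' → covB S p' p) p (λ p' → isBox S (h p' j)) j

      above⁺ : ∀ j → LabelAbove j → T (above j)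
      above⁺ j (p' , c , d , e) = anyC⁺ (covB S) p _ j p' (covB⁺ c) d (isLab⁺ e)

      above⁻ : ∀ j → T (above j) → LabelAbove j
      above⁻ j t with anyC⁻ (covB S) p _ j t
      ... | p' , c , d , e = p' , covB⁻ c , d , isLab⁻ e

      below⁺ : ∀ j → BoxBelow j → T (below j)
      below⁺ j (p' , c , d , e) =
        anyC⁺ (λ p p' → covB S p' p) p _ j p' (covB⁺ c) d (isBox⁺ e)

      below⁻ : ∀ j → T (below j) → BoxBelow j
      below⁻ j t with anyC⁻ (λ p p' → covB S p' p) p _ j t
      ... | p' , c , d , e = p' , covB⁻ c , d , isBox⁻ e

      right : ℕ → Bool
      right j = domB S p j ∧ isLab S i (h p j) ∧
        noneC (λ p p' → covB S p' p) p (λ p' → isBox S (h p' j)) j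

      right⁺ : ∀ j → Dom S p j → h p j ≡ just i → ¬ BoxBelow j → T (right j)
      right⁺ j d e nb = from T-∧ (domB⁺ d , from T-∧ (isLab⁺ e ,
        noneC⁺ (λ p p' → covB S p' p) p _ j
          (λ p' c d' b → nb (p' , covB⁻ c , d' , isBox⁻ b))))

      right⁻ : ∀ j → T (right j) → Dom S p j × h p j ≡ just i × ¬ BoxBelow j
      right⁻ j t with to (T-∧ {domB S p j}) t
      ... | d , t' with to (T-∧ {isLab S i (h p j)}) t'
      ... | e , nb = domB⁻ d , isLab⁻ e , λ { (p' , c , d' , b) →
        noneC⁻ (λ p p' → covB S p' p) p _ j nb p' (covB⁺ c) d' (isBox⁺ b) }

      left : ℕ → Bool
      left j = domB S p j ∧ isBox S (h p j) ∧
        noneC (covB S) p (λ p' → isLab S i (h p' j)) j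

      left⁺ : ∀ j → Dom S p j → h p j ≡ nothing → ¬ LabelAbove j → T (left j)
      left⁺ j d e nb = from T-∧ (domB⁺ d , from T-∧ (isBox⁺ e ,
        noneC⁺ (covB S) p _ j
          (λ p' c d' b → nb (p' , covB⁻ c , d' , isLab⁻ b))))

      left⁻ : ∀ j → T (left j) → Dom S p j × h p j ≡ nothing × ¬ LabelAbove j
      left⁻ j t with to (T-∧ {domB S p j}) t
      ... | d , t' with to (T-∧ {isBox S (h p j)}) t'
      ... | e , nb = domB⁻ d , isBox⁻ e , λ { (p' , c , d' , b) →
        noneC⁻ (covB S) p _ j nb p' (covB⁺ c) d' (isLab⁺ b) }

      at-box : ∀ j → h p j ≡ nothing → jdtStep S i h p j ≡
        (if above j then just i else if right (suc j) then just i else nothing)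
      at-box j e rewrite e = refl

      at-label : ∀ j → h p j ≡ just i → jdtStep S i h p j ≡
        (if below j then nothing else if left (j ∸ 1) then nothing else just i)
      at-label j e rewrite e with i ≟ i
      ... | yes _ = refl
      ... | no i≢i = contradiction refl i≢i

    step-other : ∀ j {x} → h p j ≡ just x → x ≢ i → jdtStep S i h p j ≡ just x
    step-other j {x} e x≢i rewrite e with x ≟ i
    ... | yes x≡i = contradiction x≡i x≢i
    ... | no _ = refl

    step-up : ∀ j → h p j ≡ nothing → LabelAbove j → jdtStep S i h p j ≡ just i
    step-up j e la = trans (at-box j e)
      (if-cases (above j) (λ _ → refl) (λ na → contradiction (above⁺ j la) na))

    step-right : ∀ j → h p j ≡ nothing → Dom S p (suc j) → h p (suc j) ≡ just i →
      ¬ BoxBelow (suc j) → jdtStep S i h p j ≡ just i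
    step-right j e d l nb = trans (at-box j e)
      (if-cases (above j) (λ _ → refl) (λ _ →
        if-cases (right (suc j)) (λ _ → refl)
          (λ nr → contradiction (right⁺ (suc j) d l nb) nr)))

    step-box : ∀ j → h p j ≡ nothing → ¬ LabelAbove j →
      ¬ (Dom S p (suc j) × h p (suc j) ≡ just i × ¬ BoxBelow (suc j)) →
      jdtStep S i h p j ≡ nothing
    step-box j e na nr = trans (at-box j e)
      (if-cases (above j) (λ a → contradiction (above⁻ j a) na) (λ _ →
        if-cases (right (suc j)) (λ r → contradiction (right⁻ (suc j) r) nr)
          (λ _ → refl)))

    step-down : ∀ j → h p j ≡ just i → BoxBelow j → jdtStep S i h p j ≡ nothing
    step-down j e la = trans (at-label j e)
      (if-cases (below j) (λ _ → refl) (λ na → contradiction (below⁺ j la) na))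

    -- Stated at `suc j` so that the predecessor tested by `jdtStep` computes to `j`. Position 0
    -- lies in no fiber.
    step-left : ∀ j → h p (suc j) ≡ just i → Dom S p j → h p j ≡ nothing →
      ¬ LabelAbove j → jdtStep S i h p (suc j) ≡ nothing
    step-left j e d l nb = trans (at-label (suc j) e)
      (if-cases (below (suc j)) (λ _ → refl) (λ _ →
        if-cases (left j) (λ _ → refl)
          (λ nr → contradiction (left⁺ j d l nb) nr)))

    step-label : ∀ j → h p (suc j) ≡ just i → ¬ BoxBelow (suc j) →
      ¬ (Dom S p j × h p j ≡ nothing × ¬ LabelAbove j) →
      jdtStep S i h p (suc j) ≡ just i
    step-label j e na nr = trans (at-label (suc j) e)
      (if-cases (below (suc j)) (λ a → contradiction (below⁻ (suc j) a) na) (λ _ →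
        if-cases (left j) (λ r → contradiction (left⁻ j r) nr)
          (λ _ → refl)))

  -- The restriction to attained labels; raising and lowering within a fiber

  module Range (q : ℕ) where

    In : Labeling S → Set
    In = InL S (Interval S q)

    fromRq : ∀ {g} → InL S (Rq S q) g → In g
    fromRq (st , wk , rg) = st , wk , λ p i d → proj₁ (rg p i d) , proj₁ (proj₂ (rg p i d))

    -- The filling `g` is itself the witness. Hence restricting to `Rq` or to the interval from 1 to
    -- `q` gives the same fillings, and plain bounds suffice from here on.
    attained : ∀ {g p i} → In g → Dom S p i → Rq S q p (g p i)
    attained {g} {p} {i} G@(st , wk , rg) d =
      proj₁ (rg p i d) , proj₂ (rg p i d) , g , G , i , d , refl

    toRq : ∀ {g} → In g → InL S (Rq S q) g
    toRq G@(st , wk , rg) = st , wk , λ p i d → attained G d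

    -- Going up in the poset, fibers start no later and end no later. So the lower bound comes from
    -- `p` and the upper bound from the later position in `p'`.
    dom-up : ∀ {p p' i j} → p ≤P p' → Dom S p i → i ≤ j → Dom S p' j → Dom S p' i
    dom-up p≤p' (l , _) i≤j (_ , r) =
      ≤-<-trans (u-anti p≤p') l , ≤-<-trans i≤j r

    dom-down : ∀ {p p' i j} → p' ≤P p → Dom S p' i → i ≤ j → Dom S p j → Dom S p' j
    dom-down p'≤p (l , _) i≤j (_ , r) =
      <-≤-trans l i≤j , <-≤-trans r (∸-monoʳ-≤ (suc ℓ) (v-mono p'≤p))

    -- Raising the whole rest of the run from `i` on keeps the fiber weakly increasing. Room at `i`
    -- alone suffices: a label `suc (g p i)` above a later place of the run would force the same
    -- label above `i`.
    module Raise (g : Labeling S) (G : In g) (p : P S) (i : ℕ) (d : Dom S p i)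
      (bound : suc (g p i) ≤ q)
      (room : ∀ p' → _<P_ S p p' → Dom S p' i → g p' i ≢ suc (g p i)) where
      private
        st = proj₁ G
        wk = proj₁ (proj₂ G)
        rg = proj₂ (proj₂ G)

      Changes : P S → ℕ → Set
      Changes p' j = p' ≡ p × i ≤ j × g p' j ≡ g p i

      changes? : ∀ p' j → Dec (Changes p' j)
      changes? p' j = (p' ≟F p) ×-dec ((i ≤? j) ×-dec (g p' j ≟ g p i))

      raised : Labeling S
      raised p' j = if ⌊ changes? p' j ⌋ then suc (g p i) else g p' j

      raised-In : In raised
      raised-In = strict , weak , range
        where
        strict : ∀ p₁ p₂ j → _<P_ S p₁ p₂ → Dom S p₁ j → Dom S p₂ j → raised p₁ j < raised p₂ j
        strict p₁ p₂ j lt d₁ d₂ with changes? p₁ j | changes? p₂ j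
        ... | yes (refl , _) | yes (refl , _) = contradiction refl (proj₂ lt)
        ... | no _ | yes (_ , _ , eq) = m≤n⇒m≤1+n (subst (g p₁ j <_) eq (st p₁ p₂ j lt d₁ d₂))
        ... | no _ | no _ = st p₁ p₂ j lt d₁ d₂
        ... | yes (refl , i≤j , eq) | no _ = ≤∧≢⇒< (subst (_< g p₂ j) eq (st p₁ p₂ j lt d₁ d₂)) ne
          where
          d' : Dom S p₂ i
          d' = dom-up (proj₁ lt) d i≤j d₂
          ne : suc (g p i) ≢ g p₂ j
          ne e = room p₂ lt d' (≤-antisym (≤-trans (wk p₂ i j i≤j d' d₂) (≤-reflexive (sym e)))
                                          (st p p₂ i lt d d'))
        weak : ∀ p' j₁ j₂ → j₁ ≤ j₂ → Dom S p' j₁ → Dom S p' j₂ → raised p' j₁ ≤ raised p' j₂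
        weak p' j₁ j₂ le d₁ d₂ with changes? p' j₁ | changes? p' j₂
        ... | yes _ | yes _ = ≤-refl
        ... | no _ | yes (_ , _ , eq) = m≤n⇒m≤1+n (subst (g p' j₁ ≤_) eq (wk p' j₁ j₂ le d₁ d₂))
        ... | no _ | no _ = wk p' j₁ j₂ le d₁ d₂
        ... | yes (refl , i≤j , eq) | no ¬c =
          ≤∧≢⇒< (subst (_≤ g p j₂) eq (wk p' j₁ j₂ le d₁ d₂))
                (λ e → ¬c (refl , ≤-trans i≤j le , sym e))
        range : ∀ p' j → Dom S p' j → Interval S q p' (raised p' j)
        range p' j d' with changes? p' j
        ... | yes _ = s≤s z≤n , bound
        ... | no _ = rg p' j d'

      raised-at : raised p i ≡ suc (g p i)
      raised-at with changes? p i
      ... | yes _ = refl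
      ... | no ¬c = contradiction (refl , ≤-refl , refl) ¬c

      raised-off : AgreeOff S p g raised
      raised-off p' j p'≢p _ with changes? p' j
      ... | yes (e , _) = contradiction e p'≢p
      ... | no _ = refl

    -- Dual to `Raise`: the run is lowered from its start up to `i`, and an obstruction below an
    -- earlier place would reappear below `i`.
    module Lower (g : Labeling S) (G : In g) (p : P S) (i : ℕ) (d : Dom S p i)
      (w : ℕ) (val : g p i ≡ suc w) (bound : 1 ≤ w)
      (room : ∀ p' → _<P_ S p' p → Dom S p' i → g p' i ≢ w) where
      private
        st = proj₁ G
        wk = proj₁ (proj₂ G)
        rg = proj₂ (proj₂ G)

      Changes : P S → ℕ → Set
      Changes p' j = p' ≡ p × j ≤ i × g p' j ≡ suc w

      changes? : ∀ p' j → Dec (Changes p' j)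
      changes? p' j = (p' ≟F p) ×-dec ((j ≤? i) ×-dec (g p' j ≟ suc w))

      lowered : Labeling S
      lowered p' j = if ⌊ changes? p' j ⌋ then w else g p' j

      lowered-In : In lowered
      lowered-In = strict , weak , range
        where
        strict : ∀ p₁ p₂ j → _<P_ S p₁ p₂ → Dom S p₁ j → Dom S p₂ j → lowered p₁ j < lowered p₂ j
        strict p₁ p₂ j lt d₁ d₂ with changes? p₁ j | changes? p₂ j
        ... | yes (refl , _) | yes (refl , _) = contradiction refl (proj₂ lt)
        ... | yes (_ , _ , eq) | no _ = <-trans (n<1+n w) (subst (_< g p₂ j) eq (st p₁ p₂ j lt d₁ d₂))
        ... | no _ | no _ = st p₁ p₂ j lt d₁ d₂
        ... | no _ | yes (refl , j≤i , eq) = ≤∧≢⇒< (≤-pred (subst (g p₁ j <_) eq (st p₁ p₂ j lt d₁ d₂))) ne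
          where
          d' : Dom S p₁ i
          d' = dom-down (proj₁ lt) d₁ j≤i d
          ne : g p₁ j ≢ w
          ne e = room p₁ lt d' (≤-antisym (≤-pred (subst (g p₁ i <_) val (st p₁ p i lt d' d)))
                                          (≤-trans (≤-reflexive (sym e)) (wk p₁ j i j≤i d₁ d')))
        weak : ∀ p' j₁ j₂ → j₁ ≤ j₂ → Dom S p' j₁ → Dom S p' j₂ → lowered p' j₁ ≤ lowered p' j₂
        weak p' j₁ j₂ le d₁ d₂ with changes? p' j₁ | changes? p' j₂
        ... | yes _ | yes _ = ≤-refl
        ... | yes (_ , _ , eq) | no _ = ≤-trans (n≤1+n w) (subst (_≤ g p' j₂) eq (wk p' j₁ j₂ le d₁ d₂))
        ... | no _ | no _ = wk p' j₁ j₂ le d₁ d₂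
        ... | no ¬c | yes (refl , j≤i , eq) =
          ≤-pred (≤∧≢⇒< (subst (g p j₁ ≤_) eq (wk p' j₁ j₂ le d₁ d₂))
                        (λ e → ¬c (refl , ≤-trans le j≤i , e)))
        range : ∀ p' j → Dom S p' j → Interval S q p' (lowered p' j)
        range p' j d' with changes? p' j
        ... | yes _ = bound , ≤-trans (n≤1+n w) (≤-trans (≤-reflexive (sym val)) (proj₂ (rg p i d)))
        ... | no _ = rg p' j d'

      lowered-at : lowered p i ≡ w
      lowered-at with changes? p i
      ... | yes _ = refl
      ... | no ¬c = contradiction (refl , ≤-refl , val) ¬c

      lowered-off : AgreeOff S p g lowered
      lowered-off p' j p'≢p _ with changes? p' j
      ... | yes (e , _) = contradiction e p'≢p
      ... | no _ = refl

-- Encoding of partially swept fillings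

-- Labels below k have already been swept and still carry the +1 that JdtPro removes at the end.
enc : ℕ → ℕ → Maybe ℕ
enc k x = if ⌊ x <? k ⌋ then just (suc x) else if ⌊ x ≟ k ⌋ then nothing else just x

enc-< : ∀ {k x} → x < k → enc k x ≡ just (suc x)
enc-< {k} {x} x<k with x <? k
... | yes _ = refl
... | no x≮k = contradiction x<k x≮k

enc-≡ : ∀ k → enc k k ≡ nothing
enc-≡ k with k <? k | k ≟ k
... | yes k<k | _ = contradiction k<k (n≮n k)
... | no _ | yes _ = refl
... | no _ | no k≢k = contradiction refl k≢k

enc-> : ∀ {k x} → k < x → enc k x ≡ just x
enc-> {k} {x} k<x with x <? k | x ≟ k
... | yes x<k | _ = contradiction k<x (<-asym x<k)
... | no _ | yes refl = contradiction k<x (n≮n k)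
... | no _ | no _ = refl

enc-box⁻ : ∀ {k x} → enc k x ≡ nothing → x ≡ k
enc-box⁻ {k} {x} eq with <-cmp x k
... | tri< x<k _ _ = contradiction (trans (sym (enc-< x<k)) eq) (λ ())
... | tri≈ _ x≡k _ = x≡k
... | tri> _ _ k<x = contradiction (trans (sym (enc-> k<x)) eq) (λ ())

-- A swept label `x < k` appears as `suc x`, which is at most `k`, so it cannot be mistaken for the
-- active label `suc k`.
enc-label⁻ : ∀ {k x} → enc k x ≡ just (suc k) → x ≡ suc k
enc-label⁻ {k} {x} eq with <-cmp x k
... | tri< x<k _ _ = contradiction
        (suc-injective (just-injective (trans (sym (enc-< x<k)) eq))) (<⇒≢ x<k)
... | tri≈ _ refl _ = contradiction (trans (sym (enc-≡ k)) eq) (λ ())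
... | tri> _ _ k<x = just-injective (trans (sym (enc-> k<x)) eq)

Mid : ℕ → ℕ → Set
Mid k x = k ≤ x × x ≤ suc k

mid? : ∀ k x → Dec (Mid k x)
mid? k x = (k ≤? x) ×-dec (x ≤? suc k)

mid-cases : ∀ {k x} → Mid k x → x ≡ k ⊎ x ≡ suc k
mid-cases (k≤x , x≤1+k) with m≤n⇒m<n∨m≡n k≤x
... | inj₁ k<x  = inj₂ (≤-antisym x≤1+k k<x)
... | inj₂ refl = inj₁ refl

mid-k : ∀ {k x} → x ≡ k → Mid k x
mid-k refl = ≤-refl , n≤1+n _

mid-sk : ∀ {k x} → x ≡ suc k → Mid k x
mid-sk refl = n≤1+n _ , ≤-refl

mid-mid : ∀ {k x y} → Mid k x → Mid k y → x < y → x ≡ k × y ≡ suc k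
mid-mid (k≤x , _) (_ , y≤1+k) x<y =
  ≤-antisym (≤-pred (≤-trans x<y y≤1+k)) k≤x , ≤-antisym y≤1+k (≤-trans (s≤s k≤x) x<y)

-- Labels below `k` carry the +1 before and after the sweep, and labels above `suc k` carry it at
-- neither time; the sweep can ignore both kinds.
enc-outside : ∀ {k x} → ¬ Mid k x →
  ∃ λ y → enc k x ≡ just y × y ≢ suc k × enc (suc k) x ≡ just y
enc-outside {k} {x} ¬mid with <-≤-connex x k
... | inj₁ x<k = suc x , enc-< x<k , (λ e → <⇒≢ x<k (suc-injective e)) , enc-< (m≤n⇒m≤1+n x<k)
... | inj₂ k≤x = x , enc-> (<-trans (n<1+n k) k<x) , (λ e → <⇒≢ k<x (sym e)) , enc-> k<x
  where k<x = ≰⇒> (λ x≤1+k → ¬mid (k≤x , x≤1+k))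

bool-cases : ∀ b → b ≡ true ⊎ b ≡ false
bool-cases true  = inj₁ refl
bool-cases false = inj₂ refl

true≢false : ∀ {b} → b ≡ true → b ≡ false → ⊥
true≢false refl ()

difference : ∀ {x y} → x ≤ y → ∃ λ d → d + x ≡ y
difference {x} {y} x≤y = y ∸ x , m∸n+n≡m x≤y

-- Blocked and free labels in a fiber

module Toggle (S : Shape) (q k : ℕ) (1≤k : 1 ≤ k) (k<q : k < q)
  (g : Labeling S) (G : InL S (Interval S q) g) where
  open Shape S
  open Range S q

  private
    strict = proj₁ G
    weak   = proj₁ (proj₂ G)
    _≺_ = _<P_ S

  dom? : ∀ p j → Dec (Dom S p j)
  dom? p j = (u p <? j) ×-dec (j <? suc ℓ ∸ v p)

  Up Down : P S → ℕ → Set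
  Up   p j = ∃ λ p' → p ≺ p' × Dom S p' j × g p' j ≡ suc k
  Down p j = ∃ λ p' → p' ≺ p × Dom S p' j × g p' j ≡ k

  up? : ∀ p j → Dec (Up p j)
  up? p j = any? λ p' → _<P?_ S p p' ×-dec (dom? p' j ×-dec (g p' j ≟ suc k))

  down? : ∀ p j → Dec (Down p j)
  down? p j = any? λ p' → _<P?_ S p' p ×-dec (dom? p' j ×-dec (g p' j ≟ k))

  -- An element strictly between would lie in the same layer and need a label strictly between `k`
  -- and `suc k`. Thus blocking, defined by the full order, is detected by the covers that `jdtStep`
  -- inspects.
  adjacent : ∀ {p p' j} → p ≺ p' → Dom S p j → Dom S p' j →
    g p j ≡ k → g p' j ≡ suc k → _⋖_ S p p'
  adjacent {p} {p'} {j} p≺p' d d' gk gk' = p≺p' , λ { r (p≺r , r≺p') →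
    let dr : Dom S r j
        dr = ≤-<-trans (u-anti (proj₁ p≺r)) (proj₁ d) ,
             <-≤-trans (proj₂ d') (∸-monoʳ-≤ (suc ℓ) (v-mono (proj₁ r≺p')))
    in <⇒≱ (subst (_< g r j) gk (strict p r j p≺r d dr))
           (≤-pred (subst (g r j <_) gk' (strict r p' j r≺p' dr d'))) }

  -- Both are phrased to be down-closed along the fiber, so that `threshold` applies: the first ends
  -- where the free labels begin, the second where they end.
  BelowFree NotAboveFree : P S → ℕ → Set
  BelowFree    p j = g p j < k ⊎ (g p j ≡ k × Up p j)
  NotAboveFree p j = g p j ≤ k ⊎ (g p j ≡ suc k × ¬ Down p j)

  module _ (p : P S) where

    fiber-≤ : suc (u p) ≤ suc ℓ ∸ v p
    fiber-≤ = m+n≤o⇒m≤o∸n (suc (u p)) (s≤s (u+v≤ℓ p))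

    -- If a `k` at `j` is blocked by `suc k` above it, a `k` at an earlier `i` is blocked by the
    -- same fiber: the label there is at most `suc k` and exceeds `k`.
    belowFree-closed : ∀ i j → u p < i → i ≤ j → j < suc ℓ ∸ v p → BelowFree p j → BelowFree p i
    belowFree-closed i j u<i i≤j j<hi = go
      where
      dj : Dom S p j
      dj = <-≤-trans u<i i≤j , j<hi
      di : Dom S p i
      di = u<i , ≤-<-trans i≤j j<hi
      le = weak p i j i≤j di dj
      go : BelowFree p j → BelowFree p i
      go (inj₁ lt) = inj₁ (≤-<-trans le lt)
      go (inj₂ (eq , p' , p≺p' , d' , eq')) with m≤n⇒m<n∨m≡n (subst (g p i ≤_) eq le)
      ... | inj₁ lt = inj₁ lt
      ... | inj₂ eqi = inj₂ (eqi , p' , p≺p' , di' ,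
              ≤-antisym (subst (g p' i ≤_) eq' (weak p' i j i≤j di' d'))
                        (subst (_< g p' i) eqi (strict p p' i p≺p' di di')))
        where di' = dom-up (proj₁ p≺p') di i≤j d'

    -- Dually, a `k` below position `i` persists below `j`: it cannot decrease, and it stays under
    -- the label `suc k`.
    notAboveFree-closed : ∀ i j → u p < i → i ≤ j → j < suc ℓ ∸ v p →
      NotAboveFree p j → NotAboveFree p i
    notAboveFree-closed i j u<i i≤j j<hi = go
      where
      dj : Dom S p j
      dj = <-≤-trans u<i i≤j , j<hi
      di : Dom S p i
      di = u<i , ≤-<-trans i≤j j<hi
      le = weak p i j i≤j di dj
      go : NotAboveFree p j → NotAboveFree p i
      go (inj₁ lt) = inj₁ (≤-trans le lt)
      go (inj₂ (eq , ¬down)) with m≤n⇒m<n∨m≡n (subst (g p i ≤_) eq le)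
      ... | inj₁ lt = inj₁ (≤-pred lt)
      ... | inj₂ eqi = inj₂ (eqi , λ { (p' , p'≺p , d' , eq') →
              let dj' = dom-down (proj₁ p'≺p) d' i≤j dj
              in ¬down (p' , p'≺p , dj' ,
                   ≤-antisym (≤-pred (subst (g p' j <_) eq (strict p' p j p'≺p dj' dj)))
                             (subst (_≤ g p' j) eq' (weak p' i j i≤j d' dj'))) })

    -- Free `k` occupy `[s, a + s)` and free `suc k` occupy `[a + s, b + (a + s))`. Either width may
    -- be 0.
    record Cuts : Set where
      field
        s a b   : ℕ
        u<s     : u p < s
        e≤hi    : b + (a + s) ≤ suc ℓ ∸ v p
        s-below : ∀ j → u p < j → j < s → BelowFree p j
        s-above : ∀ j → s ≤ j → j < suc ℓ ∸ v p → ¬ BelowFree p j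
        m-below : ∀ j → u p < j → j < a + s → g p j ≤ k
        m-above : ∀ j → a + s ≤ j → j < suc ℓ ∸ v p → ¬ g p j ≤ k
        e-below : ∀ j → u p < j → j < b + (a + s) → NotAboveFree p j
        e-above : ∀ j → b + (a + s) ≤ j → j < suc ℓ ∸ v p → ¬ NotAboveFree p j

    abstract
      cuts : Cuts
      cuts with threshold (BelowFree p) (λ j → (g p j <? k) ⊎-dec ((g p j ≟ k) ×-dec up? p j))
                  (suc (u p)) (suc ℓ ∸ v p) fiber-≤ belowFree-closed
              | threshold (λ j → g p j ≤ k) (λ j → g p j ≤? k) (suc (u p)) (suc ℓ ∸ v p) fiber-≤
                  (λ i j u<i i≤j j<hi → ≤-trans
                    (weak p i j i≤j (u<i , ≤-<-trans i≤j j<hi) (<-≤-trans u<i i≤j , j<hi)))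
              | threshold (NotAboveFree p) (λ j → (g p j ≤? k) ⊎-dec ((g p j ≟ suc k) ×-dec ¬? (down? p j)))
                  (suc (u p)) (suc ℓ ∸ v p) fiber-≤ notAboveFree-closed
      ... | s , u<s , s≤hi , s-below , s-above
          | m , u<m , m≤hi , m-below , m-above
          | e , u<e , e≤hi , e-below , e-above
          -- The cuts are ordered because the predicates are nested: `BelowFree` implies
          -- `g p j ≤ k`, which implies `NotAboveFree`.
          with difference {s} {m} (≮⇒≥ λ m<s → m-above m ≤-refl (<-≤-trans m<s s≤hi) (low (s-below m u<m m<s)))
             | difference {m} {e} (≮⇒≥ λ e<m → e-above e ≤-refl (<-≤-trans e<m m≤hi) (inj₁ (m-below e u<e e<m)))
        where
        low : ∀ {j} → BelowFree p j → g p j ≤ k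
        low (inj₁ lt) = <⇒≤ lt
        low (inj₂ (eq , _)) = ≤-reflexive eq
      ... | a , refl | b , refl = record
        { s = s ; a = a ; b = b ; u<s = u<s ; e≤hi = e≤hi ; s-below = s-below ; s-above = s-above
        ; m-below = m-below ; m-above = m-above ; e-below = e-below ; e-above = e-above }

    open Cuts cuts public

    m e : ℕ
    m = a + s
    e = b + m

    s≤m : s ≤ m
    s≤m = m≤n+m s a

    m≤e : m ≤ e
    m≤e = m≤n+m m b

    free-dom : ∀ {j} → s ≤ j → j < e → Dom S p j
    free-dom s≤j j<e = <-≤-trans u<s s≤j , <-≤-trans j<e e≤hi

    blocked-k : ∀ {j} → Dom S p j → g p j ≡ k → Up p j → j < s
    blocked-k (_ , r) eq up = ≰⇒> λ s≤j → s-above _ s≤j r (inj₂ (eq , up))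

    free-k : ∀ {j} → Dom S p j → g p j ≡ k → ¬ Up p j → s ≤ j × j < m
    free-k {j} (l , r) eq ¬up =
      ≮⇒≥ (λ j<s → no-low (s-below j l j<s)) ,
      ≰⇒> (λ m≤j → m-above j m≤j r (≤-reflexive eq))
      where
      no-low : ¬ BelowFree p j
      no-low (inj₁ lt) = <⇒≢ lt eq
      no-low (inj₂ (_ , up)) = ¬up up

    free-k⁻ : ∀ {j} → s ≤ j → j < m → g p j ≡ k × ¬ Up p j
    free-k⁻ {j} s≤j j<m = eq , λ up → s-above j s≤j (proj₂ d) (inj₂ (eq , up))
      where
      d = free-dom s≤j (<-≤-trans j<m m≤e)
      eq : g p j ≡ k
      eq = ≤-antisym (m-below j (proj₁ d) j<m) (≮⇒≥ (λ lt → s-above j s≤j (proj₂ d) (inj₁ lt)))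

    free-sk : ∀ {j} → Dom S p j → g p j ≡ suc k → ¬ Down p j → m ≤ j × j < e
    free-sk {j} (l , r) eq ¬down =
      ≮⇒≥ (λ j<m → n≮n k (subst (_≤ k) eq (m-below j l j<m))) ,
      ≰⇒> (λ e≤j → e-above j e≤j r (inj₂ (eq , ¬down)))

    free-sk⁻ : ∀ {j} → m ≤ j → j < e → g p j ≡ suc k × ¬ Down p j
    free-sk⁻ {j} m≤j j<e with free-dom (≤-trans s≤m m≤j) j<e
    ... | l , r with e-below j l j<e
    ... | inj₁ le = contradiction le (m-above j m≤j r)
    ... | inj₂ res = res

    free-mid : ∀ {i} → s ≤ i → i < e → Mid k (g p i)
    free-mid {i} s≤i i<e with i <? m
    ... | yes i<m = mid-k (proj₁ (free-k⁻ s≤i i<m))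
    ... | no i≮m = mid-sk (proj₁ (free-sk⁻ (≮⇒≥ i≮m) i<e))

    blocked-sk : ∀ {j} → Dom S p j → g p j ≡ suc k → Down p j → e ≤ j
    blocked-sk {j} (l , _) eq down = ≮⇒≥ λ j<e → no-high (e-below j l j<e)
      where
      no-high : ¬ NotAboveFree p j
      no-high (inj₁ le) = n≮n k (subst (_≤ k) eq le)
      no-high (inj₂ (_ , ¬down)) = ¬down down

    -- Blocked `k` before `s` read as labels and blocked `suc k` from `e` on read as boxes. Places
    -- carrying other labels, or outside the fiber, get the same values as mere padding.
    word : ℕ → Bool
    word j = ⌊ j <? s ⌋ ∨ (⌊ m ≤? j ⌋ ∧ ⌊ j <? e ⌋)

    word-left : ∀ j → j < s → word j ≡ true
    word-left j j<s with j <? s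
    ... | yes _ = refl
    ... | no j≮s = contradiction j<s j≮s

    word-holes : ∀ j → s ≤ j → j < m → word j ≡ false
    word-holes j s≤j j<m with j <? s | m ≤? j
    ... | yes j<s | _ = contradiction j<s (≤⇒≯ s≤j)
    ... | no _ | yes m≤j = contradiction m≤j (<⇒≱ j<m)
    ... | no _ | no _ = refl

    word-parts : ∀ j → m ≤ j → j < e → word j ≡ true
    word-parts j m≤j j<e with j <? s | m ≤? j | j <? e
    ... | yes _ | _ | _ = refl
    ... | no _ | yes _ | yes _ = refl
    ... | no _ | no m≰j | _ = contradiction m≤j m≰j
    ... | no _ | yes _ | no j≮e = contradiction j<e j≮e

    word-right : ∀ j → e ≤ j → word j ≡ false
    word-right j e≤j with j <? s | m ≤? j | j <? e
    ... | yes j<s | _ | _ = contradiction (≤-trans s≤m (≤-trans m≤e e≤j)) (<⇒≱ j<s)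
    ... | no _ | no _ | _ = refl
    ... | no _ | yes _ | yes j<e = contradiction j<e (≤⇒≯ e≤j)
    ... | no _ | yes _ | no _ = refl

    open Particles s a b word word-left word-holes word-parts word-right public
      using (state; state-left; state-right; sorted-left; sorted-right)

  -- One sweep as parallel sorting in every fiber

  box-unless : Bool → Maybe ℕ
  box-unless x = if x then just (suc k) else nothing

  -- At t = 0 the blocked labels are already exchanged, unlike in enc k ∘ g; the two
  -- starting points coincide after one step.
  virtual : ℕ → BLabeling S
  virtual t p j = if ⌊ mid? k (g p j) ⌋
    then box-unless (state p t j)
    else enc k (g p j)

  virtual-outside : ∀ t p j → ¬ Mid k (g p j) → virtual t p j ≡ enc k (g p j)
  virtual-outside t p j ¬mid with mid? k (g p j)
  ... | yes mid = contradiction mid ¬mid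
  ... | no _ = refl

  virtual-mid : ∀ t p j {x} → Mid k (g p j) → state p t j ≡ x →
    virtual t p j ≡ box-unless x
  virtual-mid t p j mid refl with mid? k (g p j)
  ... | yes _ = refl
  ... | no ¬mid = contradiction mid ¬mid

  virtual-box⁻ : ∀ t p j → virtual t p j ≡ nothing → Mid k (g p j) × state p t j ≡ false
  virtual-box⁻ t p j eq with mid? k (g p j) | state p t j
  ... | yes mid | false = mid , refl
  ... | no ¬mid | _ = contradiction (mid-k (enc-box⁻ eq)) ¬mid

  virtual-label⁻ : ∀ t p j → virtual t p j ≡ just (suc k) → Mid k (g p j) × state p t j ≡ true
  virtual-label⁻ t p j eq with mid? k (g p j) | state p t j
  ... | yes mid | true = mid , refl
  ... | no ¬mid | _ = contradiction (mid-sk (enc-label⁻ eq)) ¬mid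

  -- In one layer, p ≺ p' can carry labels from {k, k+1} only as k under k+1; both are
  -- then blocked, so in the virtual picture they are already exchanged.
  no-vertical : ∀ t {p p' j} → p ≺ p' → Dom S p j → Dom S p' j →
    virtual t p j ≡ nothing → virtual t p' j ≡ just (suc k) → ⊥
  no-vertical t {p} {p'} {j} p≺p' d d' box lab
    with virtual-box⁻ t p j box | virtual-label⁻ t p' j lab
  ... | mid , st | mid' , _ with mid-mid mid mid' (strict p p' j p≺p' d d')
  ... | gk , gk' = true≢false (state-left p t j (blocked-k p d gk (p' , p≺p' , d' , gk'))) st

  Agree : BLabeling S → BLabeling S → Set
  Agree h h' = ∀ p j → Dom S p j → h p j ≡ h' p j

  step-outside : ∀ t h p j → ¬ Mid k (g p j) → h p j ≡ enc k (g p j) →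
    jdtStep S (suc k) h p j ≡ virtual t p j
  step-outside t h p j ¬mid eq with enc-outside ¬mid
  ... | y , enc≡ , y≢ , _ =
    trans (step-other S (suc k) h p j (trans eq enc≡) y≢)
          (sym (trans (virtual-outside t p j ¬mid) enc≡))

  -- With vertical slides excluded, the step compares only neighbours in the fiber, as `shift` does.
  -- A neighbour taking part in an exchange lies on the free side of `s` or `e`, hence inside the
  -- fiber and with label `k` or `suc k`.
  step-virtual : ∀ t h → Agree h (virtual t) → Agree (jdtStep S (suc k) h) (virtual (suc t))
  step-virtual t h agree p zero    (() , _)
  step-virtual t h agree p (suc j) d with mid? k (g p (suc j))
  step-virtual t h agree p (suc j) d | no ¬mid =
    trans (step-outside (suc t) h p (suc j) ¬mid (trans (agree p (suc j) d) (virtual-outside t p (suc j) ¬mid)))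
          (virtual-outside (suc t) p (suc j) ¬mid)
  step-virtual t h agree p (suc j) d@(l , r) | yes mid =
    go (bool-cases (state p t (suc j)))
    where
    here : ∀ {x} → state p t (suc j) ≡ x → h p (suc j) ≡ box-unless x
    here st = trans (agree p (suc j) d) (virtual-mid t p (suc j) mid st)

    no-above : ∀ i → Dom S p i → h p i ≡ nothing → ¬ LabelAbove S (suc k) h p i
    no-above i di box (p' , c , d' , lab) = no-vertical t (proj₁ c) di d'
      (trans (sym (agree p i di)) box) (trans (sym (agree p' i d')) lab)

    no-below : ∀ i → Dom S p i → h p i ≡ just (suc k) → ¬ BoxBelow S (suc k) h p i
    no-below i di lab (p' , c , d' , box) = no-vertical t (proj₁ c) d' di
      (trans (sym (agree p' i d')) box) (trans (sym (agree p i di)) lab)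

    go : state p t (suc j) ≡ true ⊎ state p t (suc j) ≡ false →
      jdtStep S (suc k) h p (suc j) ≡ box-unless (state p (suc t) (suc j))
    go (inj₂ st) with bool-cases (state p t (suc (suc j)))
    ... | inj₁ st' = trans
      (step-right S (suc k) h p (suc j) (here st) d' lab (no-below (suc (suc j)) d' lab))
      (cong box-unless (sym (trans (shift-enter (state p t) (suc j) st) st')))
      where
      j<e : suc (suc j) < e p
      j<e = ≰⇒> λ e≤ → true≢false st' (state-right p t _ e≤)
      d' : Dom S p (suc (suc j))
      d' = m≤n⇒m≤1+n l , <-≤-trans j<e (e≤hi p)
      top : NotAboveFree p (suc (suc j)) → g p (suc (suc j)) ≤ suc k
      top (inj₁ le) = m≤n⇒m≤1+n le
      top (inj₂ (eq , _)) = ≤-reflexive eq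
      mid' : Mid k (g p (suc (suc j)))
      mid' = ≤-trans (proj₁ mid) (weak p _ _ (n≤1+n _) d d') ,
             top (e-below p _ (proj₁ d') j<e)
      lab = trans (agree p _ d') (virtual-mid t p _ mid' st')
    ... | inj₂ st' = trans
      (step-box S (suc k) h p (suc j) (here st) (no-above (suc j) d (here st))
        (λ { (d' , lab , _) → true≢false
               (proj₂ (virtual-label⁻ t p _ (trans (sym (agree p _ d')) lab))) st' }))
      (cong box-unless (sym (trans (shift-enter (state p t) (suc j) st) st')))
    go (inj₁ st) with bool-cases (state p t j)
    ... | inj₂ st' = trans
      (step-left S (suc k) h p j (here st) d' box (no-above j d' box))
      (cong box-unless (sym (trans (shift-leave (state p t) j st) st')))
      where
      s≤j : s p ≤ j
      s≤j = ≮⇒≥ λ j<s → true≢false (state-left p t j j<s) st'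
      d' : Dom S p j
      d' = <-≤-trans (u<s p) s≤j , <-trans (n<1+n j) r
      mid' : Mid k (g p j)
      mid' = ≮⇒≥ (λ lt → s-above p j s≤j (proj₂ d') (inj₁ lt)) ,
             ≤-trans (weak p _ _ (n≤1+n _) d' d) (proj₂ mid)
      box = trans (agree p _ d') (virtual-mid t p _ mid' st')
    ... | inj₁ st' = trans
      (step-label S (suc k) h p j (here st) (no-below (suc j) d (here st))
        (λ { (d' , box , _) → true≢false st'
               (proj₂ (virtual-box⁻ t p _ (trans (sym (agree p _ d')) box))) }))
      (cong box-unless (sym (trans (shift-leave (state p t) j st) st')))

  -- Blocked pairs slide vertically. For a free label, the diagonal tests of `jdtStep` reject
  -- exactly the blocked neighbours, and `word` already shows these as exchanged, so no horizontal
  -- move arises there either.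
  step-encoded : ∀ h → Agree h (λ p j → enc k (g p j)) → Agree (jdtStep S (suc k) h) (virtual 1)
  step-encoded h agree p zero (() , _)
  step-encoded h agree p (suc j) d@(l , r) with mid? k (g p (suc j))
  ... | no ¬mid = trans (step-outside 1 h p (suc j) ¬mid (agree p (suc j) d)) (virtual-outside 1 p (suc j) ¬mid)
  ... | yes mid = go (mid-cases mid)
    where
    box⁺ : ∀ {p i} → Dom S p i → g p i ≡ k → h p i ≡ nothing
    box⁺ di eq = trans (agree _ _ di) (trans (cong (enc k) eq) (enc-≡ k))

    box⁻ : ∀ {p i} → Dom S p i → h p i ≡ nothing → g p i ≡ k
    box⁻ di eq = enc-box⁻ (trans (sym (agree _ _ di)) eq)

    lab⁺ : ∀ {p i} → Dom S p i → g p i ≡ suc k → h p i ≡ just (suc k)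
    lab⁺ di eq = trans (agree _ _ di) (trans (cong (enc k) eq) (enc-> (n<1+n k)))

    lab⁻ : ∀ {p i} → Dom S p i → h p i ≡ just (suc k) → g p i ≡ suc k
    lab⁻ di eq = enc-label⁻ (trans (sym (agree _ _ di)) eq)

    above⁺ : ∀ {i} → Dom S p i → g p i ≡ k → Up p i → LabelAbove S (suc k) h p i
    above⁺ di eq (p' , p≺p' , d' , eq') = p' , adjacent p≺p' di d' eq eq' , d' , lab⁺ d' eq'

    above⁻ : ∀ {i} → LabelAbove S (suc k) h p i → Up p i
    above⁻ (p' , c , d' , lab) = p' , proj₁ c , d' , lab⁻ d' lab

    below⁺ : ∀ {i} → Dom S p i → g p i ≡ suc k → Down p i → BoxBelow S (suc k) h p i
    below⁺ di eq (p' , p'≺p , d' , eq') = p' , adjacent p'≺p d' di eq' eq , d' , box⁺ d' eq'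

    below⁻ : ∀ {i} → BoxBelow S (suc k) h p i → Down p i
    below⁻ (p' , c , d' , box) = p' , proj₁ c , d' , box⁻ d' box

    go : g p (suc j) ≡ k ⊎ g p (suc j) ≡ suc k →
      jdtStep S (suc k) h p (suc j) ≡ box-unless (state p 1 (suc j))
    go (inj₁ eq) with up? p (suc j)
    ... | yes up = trans (step-up S (suc k) h p (suc j) (box⁺ d eq) (above⁺ d eq up))
                         (cong box-unless (sym (state-left p 1 (suc j) (blocked-k p d eq up))))
    ... | no ¬up with free-k p d eq ¬up | bool-cases (word p (suc (suc j)))
    ... | s≤j , j<m | inj₁ st = trans
      (step-right S (suc k) h p (suc j) (box⁺ d eq) d' (lab⁺ d' (proj₁ fr)) (proj₂ fr ∘ below⁻))
      (cong box-unless (sym (trans (shift-enter (word p) (suc j) (word-holes p _ s≤j j<m)) st)))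
      where
      j<e : suc (suc j) < e p
      j<e = ≰⇒> λ e≤ → true≢false st (word-right p _ e≤)
      m≤j : m p ≤ suc (suc j)
      m≤j = ≮⇒≥ λ lt → true≢false st (word-holes p _ (m≤n⇒m≤1+n s≤j) lt)
      d' = free-dom p (m≤n⇒m≤1+n s≤j) j<e
      fr = free-sk⁻ p m≤j j<e
    ... | s≤j , j<m | inj₂ st = trans
      (step-box S (suc k) h p (suc j) (box⁺ d eq) (¬up ∘ above⁻)
        (λ { (d' , lab , nb) →
          let m≤j , j<e = free-sk p d' (lab⁻ d' lab) (nb ∘ below⁺ d' (lab⁻ d' lab))
          in true≢false (word-parts p _ m≤j j<e) st }))
      (cong box-unless (sym (trans (shift-enter (word p) (suc j) (word-holes p _ s≤j j<m)) st)))
    go (inj₂ eq) with down? p (suc j)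
    ... | yes down = trans (step-down S (suc k) h p (suc j) (lab⁺ d eq) (below⁺ d eq down))
                           (cong box-unless (sym (state-right p 1 (suc j) (blocked-sk p d eq down))))
    ... | no ¬down with free-sk p d eq ¬down | bool-cases (word p j)
    ... | m≤j , j<e | inj₂ st = trans
      (step-left S (suc k) h p j (lab⁺ d eq) d' (box⁺ d' (proj₁ fr)) (proj₂ fr ∘ above⁻))
      (cong box-unless (sym (trans (shift-leave (word p) j (word-parts p _ m≤j j<e)) st)))
      where
      s≤j : s p ≤ j
      s≤j = ≮⇒≥ λ lt → true≢false (word-left p j lt) st
      j<m : j < m p
      j<m = ≰⇒> λ m≤j → true≢false (word-parts p j m≤j (<-trans (n<1+n j) j<e)) st
      d' = free-dom p s≤j (<-≤-trans j<m (m≤e p))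
      fr = free-k⁻ p s≤j j<m
    ... | m≤j , j<e | inj₁ st = trans
      (step-label S (suc k) h p j (lab⁺ d eq) (¬down ∘ below⁻)
        (λ { (d' , box , na) →
          let s≤j , j<m = free-k p d' (box⁻ d' box) (na ∘ above⁺ d' (box⁻ d' box))
          in true≢false st (word-holes p j s≤j j<m) }))
      (cong box-unless (sym (trans (shift-leave (word p) j (word-parts p _ m≤j j<e)) st)))

  sweep-virtual : ∀ h → Agree h (λ p j → enc k (g p j)) →
    ∀ t → Agree (iter (suc t) (jdtStep S (suc k)) h) (virtual (suc t))
  sweep-virtual h agree zero    = step-encoded h agree
  sweep-virtual h agree (suc t) = step-virtual (suc t) _ (sweep-virtual h agree t)

  -- The filling produced by a sweep

  -- The cut between `k` and `suc k` moves from `a + s` to `b + s`. Blocked `k` lie before `s` and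
  -- blocked `suc k` from `e` on, so the single test leaves them unchanged.
  toggled : Labeling S
  toggled p j = if ⌊ mid? k (g p j) ⌋
    then (if ⌊ j <? b p + s p ⌋ then k else suc k)
    else g p j

  toggled-outside : ∀ p j → ¬ Mid k (g p j) → toggled p j ≡ g p j
  toggled-outside p j ¬mid with mid? k (g p j)
  ... | yes mid = contradiction mid ¬mid
  ... | no _ = refl

  toggled-k : ∀ p j → Mid k (g p j) → j < b p + s p → toggled p j ≡ k
  toggled-k p j mid lt with mid? k (g p j) | j <? b p + s p
  ... | no ¬mid | _ = contradiction mid ¬mid
  ... | yes _ | yes _ = refl
  ... | yes _ | no nlt = contradiction lt nlt

  toggled-sk : ∀ p j → Mid k (g p j) → b p + s p ≤ j → toggled p j ≡ suc k
  toggled-sk p j mid le with mid? k (g p j) | j <? b p + s p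
  ... | no ¬mid | _ = contradiction mid ¬mid
  ... | yes _ | no _ = refl
  ... | yes _ | yes lt = contradiction lt (≤⇒≯ le)

  toggled-mid : ∀ p j → Mid k (g p j) → Mid k (toggled p j)
  toggled-mid p j mid with <-≤-connex j (b p + s p)
  ... | inj₁ lt = mid-k (toggled-k p j mid lt)
  ... | inj₂ le = mid-sk (toggled-sk p j mid le)

  b+s≤e : ∀ p → b p + s p ≤ e p
  b+s≤e p = +-monoʳ-≤ (b p) (s≤m p)

  -- The free labels fit between `s`, which is at least 1, and `suc ℓ`; so `ℓ` iterations are enough
  -- to sort them.
  a+b≤ℓ : ∀ p → a p + b p ≤ ℓ
  a+b≤ℓ p = ≤-pred (begin
    suc (a p + b p)   ≡⟨ cong suc (+-comm (a p) (b p)) ⟩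
    suc (b p + a p)   ≡⟨ +-suc (b p) (a p) ⟨
    b p + suc (a p)   ≡⟨ cong (b p +_) (+-comm 1 (a p)) ⟩
    b p + (a p + 1)   ≤⟨ +-monoʳ-≤ (b p) (+-monoʳ-≤ (a p) (≤-trans (s≤s z≤n) (u<s p))) ⟩
    e p               ≤⟨ e≤hi p ⟩
    suc ℓ ∸ v p       ≤⟨ m∸n≤m (suc ℓ) (v p) ⟩
    suc ℓ             ∎)
    where open ≤-Reasoning

  -- After `ℓ` steps the words are sorted. Under `enc (suc k)` a `k` reads `just (suc k)` and a
  -- `suc k` reads as a box, which are the two letters of the sorted word. Positivity of `ℓ`
  -- guarantees the first step, from which `virtual` is valid.
  sweep-toggles : ∀ h → 1 ≤ ℓ → Agree h (λ p j → enc k (g p j)) →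
    Agree (iter ℓ (jdtStep S (suc k)) h) (λ p j → enc (suc k) (toggled p j))
  sweep-toggles h 1≤ℓ agree p j d = trans (sweep ℓ 1≤ℓ p j d) final
    where
    sweep : ∀ t → 1 ≤ t → Agree (iter t (jdtStep S (suc k)) h) (virtual t)
    sweep (suc t) _ = sweep-virtual h agree t
    final : virtual ℓ p j ≡ enc (suc k) (toggled p j)
    final with mid? k (g p j)
    ... | no ¬mid with enc-outside ¬mid
    ...   | y , e₁ , _ , e₂ = trans e₁ (sym e₂)
    final | yes mid with j <? b p + s p
    ... | yes lt rewrite sorted-left p ℓ (a+b≤ℓ p) j lt = sym (enc-< (n<1+n k))
    ... | no nlt rewrite sorted-right p ℓ (a+b≤ℓ p) j (≮⇒≥ nlt) = sym (enc-≡ (suc k))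

  -- Outside the free interval a `k` or `suc k` must be blocked, and then it lies on the matching
  -- side of the cut.
  toggled-fixed : ∀ {p j} → Dom S p j → ¬ (s p ≤ j × j < e p) → toggled p j ≡ g p j
  toggled-fixed {p} {j} d nf with mid? k (g p j)
  ... | no ¬mid = refl
  ... | yes mid with j <? b p + s p | mid-cases mid
  ...   | yes _ | inj₁ eq = sym eq
  ...   | no _ | inj₂ eq = sym eq
  ...   | yes lt | inj₂ eq with down? p j
  ...     | yes down = contradiction (<-≤-trans lt (b+s≤e p)) (≤⇒≯ (blocked-sk p d eq down))
  ...     | no ¬down = let m≤j , j<e = free-sk p d eq ¬down in
                       contradiction (≤-trans (s≤m p) m≤j , j<e) nf
  toggled-fixed {p} {j} d nf | yes mid | no nlt | inj₁ eq with up? p j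
  ...     | yes up = contradiction (<-≤-trans (blocked-k p d eq up) (m≤n+m (s p) (b p))) nlt
  ...     | no ¬up = let s≤j , j<m = free-k p d eq ¬up in
                     contradiction (s≤j , <-≤-trans j<m (m≤e p)) nf

  -- Two related places in a layer that both carry `k` or `suc k` are blocked, hence unchanged.
  -- Against any other label, staying within `k` and `suc k` preserves the inequality.
  toggled-In : In toggled
  toggled-In = strict' , weak' , range
    where
    strict' : ∀ p₁ p₂ i → p₁ ≺ p₂ → Dom S p₁ i → Dom S p₂ i → toggled p₁ i < toggled p₂ i
    strict' p₁ p₂ i lt d₁ d₂ = go (mid? k (g p₁ i)) (mid? k (g p₂ i))
      where
      base = strict p₁ p₂ i lt d₁ d₂
      go : Dec (Mid k (g p₁ i)) → Dec (Mid k (g p₂ i)) → toggled p₁ i < toggled p₂ i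
      go (yes m₁) (yes m₂) with mid-mid m₁ m₂ base
      ... | eq₁ , eq₂ = subst₂ _<_
        (sym (toggled-fixed d₁ (λ (s≤i , _) →
          <⇒≱ (blocked-k p₁ d₁ eq₁ (p₂ , lt , d₂ , eq₂)) s≤i)))
        (sym (toggled-fixed d₂ (λ (_ , i<e) →
          <⇒≱ i<e (blocked-sk p₂ d₂ eq₂ (p₁ , lt , d₁ , eq₁)))))
        base
      go (yes m₁) (no ¬m₂) = ≤-<-trans (proj₂ (toggled-mid p₁ i m₁))
        (subst (suc k <_) (sym (toggled-outside p₂ i ¬m₂))
          (≰⇒> λ le → ¬m₂ (≤-trans (proj₁ m₁) (<⇒≤ base) , le)))
      go (no ¬m₁) (yes m₂) = <-≤-trans
        (subst (_< k) (sym (toggled-outside p₁ i ¬m₁))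
          (≰⇒> λ le → ¬m₁ (le , ≤-trans (<⇒≤ base) (proj₂ m₂))))
        (proj₁ (toggled-mid p₂ i m₂))
      go (no ¬m₁) (no ¬m₂) = subst₂ _<_ (sym (toggled-outside p₁ i ¬m₁))
        (sym (toggled-outside p₂ i ¬m₂)) base
    weak' : ∀ p i₁ i₂ → i₁ ≤ i₂ → Dom S p i₁ → Dom S p i₂ → toggled p i₁ ≤ toggled p i₂
    weak' p i₁ i₂ le d₁ d₂ = go (mid? k (g p i₁)) (mid? k (g p i₂))
      where
      base = weak p i₁ i₂ le d₁ d₂
      go : Dec (Mid k (g p i₁)) → Dec (Mid k (g p i₂)) → toggled p i₁ ≤ toggled p i₂
      go (yes m₁) (yes m₂) with <-≤-connex i₁ (b p + s p)
      ... | inj₁ lt = subst (_≤ toggled p i₂) (sym (toggled-k p i₁ m₁ lt)) (proj₁ (toggled-mid p i₂ m₂))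
      ... | inj₂ ge = ≤-reflexive (trans (toggled-sk p i₁ m₁ ge)
                        (sym (toggled-sk p i₂ m₂ (≤-trans ge le))))
      go (yes m₁) (no ¬m₂) = ≤-trans (proj₂ (toggled-mid p i₁ m₁))
        (subst (suc k ≤_) (sym (toggled-outside p i₂ ¬m₂))
          (<⇒≤ (≰⇒> λ le → ¬m₂ (≤-trans (proj₁ m₁) base , le))))
      go (no ¬m₁) (yes m₂) = ≤-trans
        (subst (_≤ k) (sym (toggled-outside p i₁ ¬m₁))
          (<⇒≤ (≰⇒> λ le → ¬m₁ (le , ≤-trans base (proj₂ m₂)))))
        (proj₁ (toggled-mid p i₂ m₂))
      go (no ¬m₁) (no ¬m₂) = subst₂ _≤_ (sym (toggled-outside p i₁ ¬m₁))
        (sym (toggled-outside p i₂ ¬m₂)) base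
    range : ∀ p i → Dom S p i → Interval S q p (toggled p i)
    range p i d with mid? k (g p i) | toggled-mid p i
    ... | yes mid | tm = ≤-trans 1≤k (proj₁ (tm mid)) , ≤-trans (proj₂ (tm mid)) k<q
    ... | no ¬mid | _ = proj₂ (proj₂ G) p i d

  -- Comparison with the Bender-Knuth toggle

  -- The competing filling may alter all of fiber `p` but no other fiber, so a `suc k` above still
  -- caps the label.
  raisable⁻ : ∀ {p i} → Dom S p i → g p i ≡ k → Raisable S (Rq S q) g p i → ¬ Up p i
  raisable⁻ {p} {i} d eq (g₂ , G₂ , lt , off) (p' , p≺p' , d' , eq') =
    <⇒≱ (subst (g₂ p i <_) (trans (off p' i (≢-sym (proj₂ p≺p')) d') eq') (proj₁ G₂ p p' i p≺p' d d'))
        (subst (_< g₂ p i) eq lt)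

  raised-exists : ∀ {p i} → Dom S p i → g p i ≡ k → ¬ Up p i →
    ∃ λ g₂ → In g₂ × g₂ p i ≡ suc k × AgreeOff S p g g₂
  raised-exists {p} {i} d eq ¬up =
    raised , raised-In , trans raised-at (cong suc eq) , raised-off
    where
    open Raise g G p i d (subst (_< q) (sym eq) k<q)
      (λ p' p≺p' d' e' → ¬up (p' , p≺p' , d' , trans e' (cong suc eq)))

  lowered-exists : ∀ {p i w} → Dom S p i → g p i ≡ suc w → 1 ≤ w →
    (∀ p' → p' ≺ p → Dom S p' i → g p' i ≢ w) →
    ∃ λ g₂ → In g₂ × g₂ p i ≡ w × AgreeOff S p g g₂
  lowered-exists {p} {i} {w} d eq 1≤w room = lowered , lowered-In , lowered-at , lowered-off
    where open Lower g G p i d w eq 1≤w room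

  lowerable⁻ : ∀ {p i w} → Dom S p i → g p i ≡ suc w → Lowerable S (Rq S q) g p i →
    ∀ p' → p' ≺ p → Dom S p' i → g p' i ≢ w
  lowerable⁻ {p} {i} d eq (g₂ , G₂ , lt , off) p' p'≺p d' eq' =
    <⇒≱ (subst (_< g₂ p i) (trans (off p' i (proj₂ p'≺p) d') eq') (proj₁ G₂ p' p i p'≺p d' d))
        (≤-pred (subst (g₂ p i <_) eq lt))

  attained-at : ∀ {g₂ p i x} → In g₂ → Dom S p i → g₂ p i ≡ x → Rq S q p x
  attained-at {p = p} G₂ d eq = subst (Rq S q p) eq (attained G₂ d)

  -- One of the two labels is present at `i`; raising or lowering it attains the other.
  free-active : ∀ {p i} → s p ≤ i → i < e p → Rq S q p k × Rq S q p (suc k)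
  free-active {p} {i} s≤i i<e with i <? m p
  ... | yes i<m with free-k⁻ p s≤i i<m
  ...   | eq , ¬up with raised-exists (free-dom p s≤i i<e) eq ¬up
  ...     | g₂ , G₂ , eq₂ , _ =
            attained-at G (free-dom p s≤i i<e) eq , attained-at G₂ (free-dom p s≤i i<e) eq₂
  free-active {p} {i} s≤i i<e | no i≮m with free-sk⁻ p (≮⇒≥ i≮m) i<e
  ... | eq , ¬down with lowered-exists (free-dom p s≤i i<e) eq 1≤k
                          (λ p' p'≺p d' e' → ¬down (p' , p'≺p , d' , e'))
  ...   | g₂ , G₂ , eq₂ , _ =
          attained-at G₂ (free-dom p s≤i i<e) eq₂ , attained-at G (free-dom p s≤i i<e) eq

  module _ {p nxt} (isNext : IsNext S q p k nxt) where

    next-≡ : Rq S q p (suc k) → nxt ≡ suc k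
    next-≡ r = ≤-antisym (proj₂ (proj₂ isNext) (suc k) r (n<1+n k)) (proj₁ (proj₂ isNext))

    -- Together with `Free⁻` this identifies the free labels with the interval `[s, e)`, whose
    -- counts are then explicit.
    Free⁺ : ∀ {i} → s p ≤ i → i < e p → Free S q g p k nxt i
    Free⁺ {i} s≤i i<e with next-≡ (proj₂ (free-active s≤i i<e)) | i <? m p
    ... | refl | yes i<m with free-k⁻ p s≤i i<m
    ...   | eq , ¬up with raised-exists (free-dom p s≤i i<e) eq ¬up
    ...     | g₂ , G₂ , eq₂ , off = free-dom p s≤i i<e ,
              inj₁ (eq , g₂ , toRq G₂ , subst₂ _<_ (sym eq) (sym eq₂) (n<1+n k) , off)
    Free⁺ {i} s≤i i<e | refl | no i≮m with free-sk⁻ p (≮⇒≥ i≮m) i<e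
    ... | eq , ¬down with lowered-exists (free-dom p s≤i i<e) eq 1≤k
                            (λ p' p'≺p d' e' → ¬down (p' , p'≺p , d' , e'))
    ...   | g₂ , G₂ , eq₂ , off = free-dom p s≤i i<e ,
            inj₂ (eq , g₂ , toRq G₂ , subst₂ _<_ (sym eq₂) (sym eq) (n<1+n k) , off)

    -- If the next element of R(p) were larger than k + 1, lowering the label by one
    -- would produce an element of R(p) strictly between.
    lowerable-next : ∀ {i w} → Dom S p i → g p i ≡ w → w ≡ nxt →
      Lowerable S (Rq S q) g p i → w ≡ suc k
    lowerable-next {i} {zero} d eq refl low = contradiction (proj₁ (proj₂ isNext)) (λ ())
    lowerable-next {i} {suc w} d eq refl low with m≤n⇒m<n∨m≡n (≤-pred (proj₁ (proj₂ isNext)))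
    ... | inj₂ refl = refl
    ... | inj₁ k<w with lowered-exists d eq (≤-trans 1≤k (<⇒≤ k<w)) (lowerable⁻ d eq low)
    ...   | g₂ , G₂ , eq₂ , _ =
            contradiction (proj₂ (proj₂ isNext) w (attained-at G₂ d eq₂) k<w) (n≮n w)

    Free⁻ : ∀ {i} → Free S q g p k nxt i → s p ≤ i × i < e p
    Free⁻ (d , inj₁ (eq , rais)) with free-k p d eq (raisable⁻ d eq rais)
    ... | s≤i , i<m = s≤i , <-≤-trans i<m (m≤e p)
    Free⁻ {i} (d , inj₂ (eq , low)) with lowerable-next d refl eq low
    ... | eq' with free-sk p d eq' (λ (p' , p'≺p , d' , e') → lowerable⁻ d eq' low p' p'≺p d' e')
    ...   | m≤i , i<e = ≤-trans (s≤m p) m≤i , i<e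

    free-nxt : ∀ {i} → Free S q g p k nxt i → nxt ≡ suc k
    free-nxt fr = let s≤i , i<e = Free⁻ fr in next-≡ (proj₂ (free-active s≤i i<e))

    swap : Swap S q p k nxt g toggled
    swap = (λ i d nf → toggled-fixed d (λ (s≤i , i<e) → nf (Free⁺ s≤i i<e))) , counted
      where
      counted : ∀ b' → CountBelow (λ j → Free S q g p k nxt j × g p j ≡ nxt) (suc ℓ) b' →
        ∀ i c → Free S q g p k nxt i → CountBelow (Free S q g p k nxt) i c →
        (c < b' → toggled p i ≡ k) × (b' ≤ c → toggled p i ≡ nxt)
      -- The counts evaluate to `b' = b p` and `c = i ∸ s p`, so comparing them is comparing `i`
      -- with `b p + s p`.
      counted b' cntb i c fr cntc =
        (λ c<b' → toggled-k p i mid (below (subst₂ _<_ c≡ b'≡ c<b'))) ,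
        (λ b'≤c → trans (toggled-sk p i mid (above (subst₂ _≤_ b'≡ c≡ b'≤c))) (sym nxt≡))
        where
        nxt≡ = free-nxt fr
        s≤i = proj₁ (Free⁻ fr)
        i<e = proj₂ (Free⁻ fr)
        mid = free-mid p s≤i i<e
        last : ∀ j → Free S q g p k nxt j × g p j ≡ nxt → m p ≤ j × j < e p
        last j (frj , eq) =
          ≮⇒≥ (λ j<m → n≮n k (subst (_≤ k) (trans eq nxt≡) (m-below p j (proj₁ (proj₁ frj)) j<m))) ,
          proj₂ (Free⁻ frj)
        b'≡ : b' ≡ b p
        b'≡ = begin
          b'                 ≡⟨ count-interval (m p) (e p) (m≤e p) last
                                  (λ j m≤j j<e → Free⁺ (≤-trans (s≤m p) m≤j) j<e ,
                                     trans (proj₁ (free-sk⁻ p m≤j j<e)) (sym nxt≡)) cntb ⟩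
          suc ℓ ⊓ e p ∸ m p  ≡⟨ cong (_∸ m p) (m≥n⇒m⊓n≡n (≤-trans (e≤hi p) (m∸n≤m (suc ℓ) (v p)))) ⟩
          e p ∸ m p          ≡⟨ m+n∸n≡m (b p) (m p) ⟩
          b p                ∎
          where open ≡-Reasoning
        c≡ : c ≡ i ∸ s p
        c≡ = trans (count-interval (s p) (e p) (≤-trans (s≤m p) (m≤e p))
                     (λ j → Free⁻) (λ j → Free⁺) cntc)
                   (cong (_∸ s p) (m≤n⇒m⊓n≡m (<⇒≤ i<e)))
        back : i ∸ s p + s p ≡ i
        back = m∸n+n≡m s≤i
        below : i ∸ s p < b p → i < b p + s p
        below lt = subst (_< b p + s p) back (+-monoˡ-< (s p) lt)
        above : b p ≤ i ∸ s p → b p + s p ≤ i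
        above le = subst (b p + s p ≤_) back (+-monoˡ-≤ (s p) le)

  toggled-BK : BK S q k g toggled
  toggled-BK p =
    -- A free place would make `k` active in this fiber, so here nothing is free and the fiber is
    -- fixed.
    (λ inactive i d → toggled-fixed d (λ (s≤i , i<e) →
       let rk , rsk = free-active s≤i i<e in inactive (rk , suc k , rsk , n<1+n k))) ,
    (λ _ nxt isNext → swap isNext)

-- Induction over the sweeps

sweeps-suc : ∀ S n h →
  sweeps S (suc (suc n)) h ≡ iter (Shape.ℓ S) (jdtStep S (suc (suc n))) (sweeps S (suc n) h)
sweeps-suc S n h = begin
  foldl F h (map (2 +_) (upTo (suc n)))   ≡⟨ cong (foldl F h ∘ map (2 +_)) (upTo-∷ʳ n) ⟨
  foldl F h (map (2 +_) (upTo n ∷ʳ n))    ≡⟨ cong (foldl F h) (map-++ (2 +_) (upTo n) (n ∷ [])) ⟩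
  foldl F h (map (2 +_) (upTo n) ∷ʳ 2+ n) ≡⟨ foldl-∷ʳ F h (2+ n) (map (2 +_) (upTo n)) ⟩
  F (foldl F h (map (2 +_) (upTo n))) (2+ n) ∎
  where
  open ≡-Reasoning
  F : BLabeling S → ℕ → BLabeling S
  F h i = iter (Shape.ℓ S) (jdtStep S i) h

oneToBox-enc : ∀ S (f : Labeling S) p j → 1 ≤ f p j → oneToBox S f p j ≡ enc 1 (f p j)
oneToBox-enc S f p j 1≤f with f p j
oneToBox-enc S f p j () | zero
... | suc zero = refl
... | 2+ x = refl

-- At the end every entry is one too large: swept labels carry their +1, and a box standing for `q`
-- becomes `suc q`. The final subtraction corrects both.
boxTo-enc : ∀ S {q x} h p j → h p j ≡ enc q x → x ≤ q → boxTo S q h p j ∸ 1 ≡ x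
boxTo-enc S {q} {x} h p j eq x≤q with m≤n⇒m<n∨m≡n x≤q
... | inj₁ x<q rewrite trans eq (enc-< x<q) = refl
... | inj₂ refl rewrite trans eq (enc-≡ q) = refl

-- The invariant of the induction, with a shift of indices: `sweeps S (suc n)` treats labels 2 to
-- `n + 1`, which matches the toggles 1 to `n`. Membership of `g` is carried along because the next
-- toggle needs it.
reached : ∀ S q → 1 ≤ Shape.ℓ S → ∀ f → InL S (Interval S q) f → ∀ n → n < q →
  ∃ λ g → InL S (Interval S q) g × ProSteps S q n f g ×
          (∀ p j → Dom S p j → sweeps S (suc n) (oneToBox S f) p j ≡ enc (suc n) (g p j))
reached S q 1≤ℓ f F@(_ , _ , range) zero n<q =
  f , F , (λ _ _ _ → refl) , λ p j d → oneToBox-enc S f p j (proj₁ (range p j d))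
reached S q 1≤ℓ f F (suc n) n<q with reached S q 1≤ℓ f F n (<-trans (n<1+n n) n<q)
... | g , G , pro , agree =
  toggled , toggled-In , (g , pro , toggled-BK) , λ p j d →
    trans (cong (λ h → h p j) (sweeps-suc S n (oneToBox S f)))
          (sweep-toggles _ 1≤ℓ agree p j d)
  where open Toggle S q (suc n) (s≤s z≤n) n<q g G

theorem3p10 : (S : Shape) (q : ℕ) → 1 ≤ Shape.ℓ S → 1 ≤ q → RqDefined S q →
    (f : Labeling S) → InL S (Rq S q) f → ProIs S q f (JdtPro S q f)
theorem3p10 S (suc n) 1≤ℓ 1≤q _ f F
  with reached S (suc n) 1≤ℓ f (Range.fromRq S (suc n) F) n (n<1+n n)
-- The sweeps account for the toggles 1 to `q - 1`. The last toggle demanded by `ProIs` has index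
-- `q` and is the identity, since no attained label exceeds `q`.
... | g , (_ , _ , range) , pro , agree = g , pro , λ p →
  (λ _ i d → boxTo-enc S (sweeps S (suc n) (oneToBox S f)) p i (agree p i d) (proj₂ (range p i d))) ,
  (λ (_ , r , (_ , r≤q , _) , q<r) → contradiction r≤q (<⇒≱ q<r))
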